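{- Let $q$ be a prime power, $n\ge1$, and let $k$ be an odd integer with $1\le k\le n$. Let $U\subseteq H_n(\mathbb{F}_{q^2})$ be any constant rank-distance $k$ set. Then $|U|\le q^k$.
   Context: $H_n(\mathbb{F}_{q^2})$ is the set of $n\times n$ hermitian matrices over $\mathbb{F}_{q^2}$ (matrices $A$ with $\overline{A}^T=A$, $\overline{\cdot}$ being $x\mapsto x^q$ entrywise). A constant rank-distance $k$ set is a set $U$ of $n\times n$ matrices with $\mathrm{rank}(A-B)=k$ for all distinct $A,B\in U$ and $\mathrm{rank}(A)=k$ for all nonzero $A\in U$. -}

module Defs where

open import Level using (Level; _⊔_)
open import Algebra.Bundles using (CommutativeRing)
open import Data.Nat using (ℕ; zero; suc; _≤_; _^_)
import Data.Nat as ℕ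
open import Data.Nat.Primality using (Prime)
open import Data.Fin using (Fin; zero; suc)
open import Data.Product using (Σ; ∃; _×_; _,_)
open import Relation.Nullary using (¬_)
open import Relation.Binary.PropositionalEquality using (_≡_)
open import Function.Definitions using (Injective)

IsPrimePower : ℕ → Set
IsPrimePower q = ∃ λ p → ∃ λ e → Prime p × (1 ≤ e) × (q ≡ p ^ e)

module _ {c ℓ : Level} (R : CommutativeRing c ℓ) where
  open CommutativeRing R hiding (zero)

  IsField : Set (c ⊔ ℓ)
  IsField = (¬ (1# ≈ 0#)) × (∀ x → ¬ (x ≈ 0#) → ∃ λ y → (x * y) ≈ 1#)

  HasCardinality : ℕ → Set (c ⊔ ℓ)
  HasCardinality N = Σ (Fin N → Carrier) λ e →
    (∀ i j → e i ≈ e j → i ≡ j) × (∀ x → ∃ λ i → e i ≈ x)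

  pow : Carrier → ℕ → Carrier
  pow x zero    = 1#
  pow x (suc m) = x * pow x m

  sumF : ∀ {m} → (Fin m → Carrier) → Carrier
  sumF {zero}  f = 0#
  sumF {suc m} f = f zero + sumF (λ i → f (suc i))

  Mat : ℕ → Set c
  Mat n = Fin n → Fin n → Carrier

  _-M_ : ∀ {n} → Mat n → Mat n → Mat n
  (A -M B) i j = A i j - B i j

  IsZeroMat : ∀ {n} → Mat n → Set ℓ
  IsZeroMat A = ∀ i j → A i j ≈ 0#

  IsHermitian : ℕ → ∀ {n} → Mat n → Set ℓ
  IsHermitian q A = ∀ i j → A j i ≈ pow (A i j) q

  LinIndep : ∀ {n r} → (Fin r → Fin n → Carrier) → Set (c ⊔ ℓ)
  LinIndep {n} {r} v = (coef : Fin r → Carrier) →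
    (∀ j → sumF (λ i → coef i * v i j) ≈ 0#) → ∀ i → coef i ≈ 0#

  RankAtLeast : ∀ {n} → Mat n → ℕ → Set (c ⊔ ℓ)
  RankAtLeast {n} A r = Σ (Fin r → Fin n) λ σ →
    Injective _≡_ _≡_ σ × LinIndep (λ i → A (σ i))

  HasRank : ∀ {n} → Mat n → ℕ → Set (c ⊔ ℓ)
  HasRank A r = RankAtLeast A r × ¬ RankAtLeast A (suc r)

OddNat : ℕ → Set
OddNat k = ∃ λ t → k ≡ suc (2 ℕ.* t)

-- For a hermitian matrix A put f_A(x) = x* A x, which lies in F_q. Cauchy–Schwarz over the at most q values
-- gives at least m²/q pairs (A, B) ∈ U² with f_A(x) = f_B(x), and m² such pairs for x = 0. Summing over x
-- bounds from below the number of zeros of the forms f_{A−B}. A hermitian form of odd rank k on the space of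
-- Q = q^(2n) vectors has exactly (Q − (q − 1) Q / q^k) / q zeros, fewer than the average Q / q, and comparing
-- the two counts gives m ≤ q^k. The number of zeros is found by splitting off a non-isotropic vector v:
-- if W has Z isotropic vectors and W ∩ v^⊥ has Z′, then Z + q Z′ = (q + 1) |W ∩ v^⊥|, because
-- a ↦ a^(q+1) takes each nonzero value in F_q exactly q + 1 times.

module Submission where

open import Defs
open import Level using (Level; _⊔_; Lift; lift)
open import Algebra.Bundles using (CommutativeRing; CommutativeMonoid; RawRing)
import Algebra.Properties.AbelianGroup as AbelianGroupProperties
import Algebra.Properties.CommutativeMonoid.Sum as MonoidSum
import Algebra.Properties.CommutativeSemiring.Binomial as BinomialTheorem
import Algebra.Properties.CommutativeSemiring.Exp as CommutativeSemiringExp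
import Algebra.Properties.Ring as RingProperties
import Algebra.Properties.Semiring.Exp as SemiringExp
import Algebra.Properties.Semiring.Mult as SemiringMult
import Algebra.Properties.Semiring.Sum as SemiringSum
import Algebra.Solver.Ring as RingSolver
import Algebra.Solver.Ring.AlmostCommutativeRing as ACR
open import Data.Empty using (⊥-elim)
open import Data.Fin using (Fin; zero; suc; fromℕ; inject₁; punchIn; combine; finToFun; funToFin)
import Data.Fin.Permutation as Perm
import Data.Fin.Properties as Finₚ
open import Data.List using (List; []; _∷_; length; replicate)
import Data.List.Properties as Listₚ
open import Data.Maybe using (Maybe; just; nothing)
open import Data.Nat using (ℕ; zero; suc; _+_; _*_; _∸_; _≤_; _<_; z≤n; s≤s; _^_)
import Data.Nat as ℕ
open import Data.Nat.Combinatorics using (_C_; nCn≡1; nC1≡n; nCk+nC[k+1]≡[n+1]C[k+1]; k>n⇒nCk≡0)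
open import Data.Nat.Divisibility using (_∣_; divides; >⇒∤)
open import Data.Nat.Primality using (Prime; euclidsLemma; prime⇒nonZero; prime⇒nonTrivial)
import Data.Nat.Properties as ℕₚ
open import Data.Nat.Tactic.RingSolver using (solve-∀)
open import Data.Product using (∃; _×_; _,_; proj₁; proj₂)
open import Data.Sum using (_⊎_; inj₁; inj₂)
open import Data.Unit using (⊤; tt)
import Data.Vec.Functional.Relation.Binary.Equality.Setoid as VectorEquality
open import Function using (_∘_)
open import Relation.Binary.Bundles using (Setoid)
open import Relation.Binary.Definitions using (tri<; tri≈; tri>)
open import Relation.Binary.PropositionalEquality as ≡ using (_≡_; _≢_)
import Relation.Binary.Reasoning.Setoid as SetoidReasoning
open import Relation.Nullary using (¬_; Dec; yes; no; ¬?; _×-dec_)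

-- Sums of natural numbers over finite setoids

-- Write κ = q^k, t = q - 1, G = q^(2n). Adding up the zero counts over all pairs gives an exact
-- identity for S = q · `agreements-total`; inserting S ≥ m²G + t m² leaves κm + mG ≤ (κ + 1)G.
-- Without the surplus from x = 0 this would only say m ≤ κ + 1; the positive term κm excludes
-- equality. Oddness of k enters through the sign (-1)^k in the zero count: for even k the forms
-- have more zeros than average and the comparison yields no contradiction. Since the counts live in
-- ℕ, they are multiplied by q and q^k instead of divided, and the sign is carried by `Alternating`.
-- Dimension never appears: subspaces are measured by cardinality and the rank enters through the
-- size of the kernel. F_q is only the fixed set of x ↦ x^q, and what is used of it comes from
-- counting roots of monic polynomials. A form of rank k < n is degenerate; every subspace met while
-- splitting contains the radical, so no quotient space is formed.

module ℕΣ = SemiringSum ℕₚ.+-*-semiring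
open ℕΣ using (sum; sum-cong-≗; ∑-comm; ∑-distrib-+; *-distribˡ-sum; *-distribʳ-sum)

𝟙 : ∀ {p} {P : Set p} → Dec P → ℕ
𝟙 (yes _) = 1
𝟙 (no  _) = 0

𝟙-yes : ∀ {p} {P : Set p} (d : Dec P) → P → 𝟙 d ≡ 1
𝟙-yes (yes _) _ = ≡.refl
𝟙-yes (no ¬p) p = ⊥-elim (¬p p)

𝟙-no : ∀ {p} {P : Set p} (d : Dec P) → ¬ P → 𝟙 d ≡ 0
𝟙-no (yes p) ¬p = ⊥-elim (¬p p)
𝟙-no (no _)  _  = ≡.refl

𝟙-cong : ∀ {p r} {P : Set p} {R : Set r} (d : Dec P) (d′ : Dec R) → (P → R) → (R → P) → 𝟙 d ≡ 𝟙 d′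
𝟙-cong (yes p) d′ f g = ≡.sym (𝟙-yes d′ (f p))
𝟙-cong (no ¬p) d′ f g = ≡.sym (𝟙-no d′ (¬p ∘ g))

sum-mono : ∀ {n} {f g : Fin n → ℕ} → (∀ i → f i ≤ g i) → sum f ≤ sum g
sum-mono {zero}  f≤g = z≤n
sum-mono {suc n} f≤g = ℕₚ.+-mono-≤ (f≤g zero) (sum-mono (f≤g ∘ suc))

sum-const : ∀ n c → sum {n} (λ _ → c) ≡ n * c
sum-const zero    c = ≡.refl
sum-const (suc n) c = ≡.cong (c +_) (sum-const n c)

sum-zero : ∀ {n} {f : Fin n → ℕ} → (∀ i → f i ≡ 0) → sum f ≡ 0
sum-zero {n} f≡0 = ≡.trans (sum-cong-≗ f≡0) (≡.trans (sum-const n 0) (ℕₚ.*-zeroʳ n))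

sum-δ : ∀ {n} (j : Fin n) → sum (λ i → 𝟙 (i Finₚ.≟ j)) ≡ 1
sum-δ {suc n} zero = ≡.cong suc (sum-zero {n} (λ i → 𝟙-no (suc i Finₚ.≟ zero) λ ()))
sum-δ {suc n} (suc j) = ≡.trans
  (sum-cong-≗ {n} (λ i → 𝟙-cong (suc i Finₚ.≟ suc j) (i Finₚ.≟ j) Finₚ.suc-injective (≡.cong suc)))
  (sum-δ j)

-- With the totals in the reverse order, no single inequality can have slack. This turns upper
-- bounds on fibres into exact sizes.
sum-equality : ∀ {n} {f g : Fin n → ℕ} → (∀ i → f i ≤ g i) → sum g ≤ sum f → ∀ i → f i ≡ g i
sum-equality {suc n} {f} {g} f≤g Σg≤Σf = λ
  { zero    → ℕₚ.≤-antisym (f≤g zero) g₀≤f₀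
  ; (suc i) → sum-equality (f≤g ∘ suc) tail≤ i }
  where
  g₀≤f₀ : g zero ≤ f zero
  g₀≤f₀ = ℕₚ.+-cancelʳ-≤ (sum (f ∘ suc)) _ _
    (ℕₚ.≤-trans (ℕₚ.+-monoʳ-≤ (g zero) (sum-mono (f≤g ∘ suc))) Σg≤Σf)
  tail≤ : sum (g ∘ suc) ≤ sum (f ∘ suc)
  tail≤ = ℕₚ.+-cancelˡ-≤ (g zero) _ _
    (ℕₚ.≤-trans Σg≤Σf (ℕₚ.+-monoˡ-≤ (sum (f ∘ suc)) (f≤g zero)))

2ab≤a²+b² : ∀ a b → 2 * (a * b) ≤ a * a + b * b
2ab≤a²+b² a b with ℕₚ.≤-total a b
... | inj₁ a≤b = ≡.subst (λ t → 2 * (a * t) ≤ a * a + t * t) (ℕₚ.m+[n∸m]≡n a≤b)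
  (≡.subst (2 * (a * (a + (b ∸ a))) ≤_) (≡.sym (expand a (b ∸ a))) (ℕₚ.m≤m+n _ _))
  where
  expand : ∀ a d → a * a + (a + d) * (a + d) ≡ 2 * (a * (a + d)) + d * d
  expand = solve-∀
... | inj₂ b≤a = ≡.subst (λ t → 2 * (t * b) ≤ t * t + b * b) (ℕₚ.m+[n∸m]≡n b≤a)
  (≡.subst (2 * ((b + (a ∸ b)) * b) ≤_) (≡.sym (expand b (a ∸ b))) (ℕₚ.m≤m+n _ _))
  where
  expand : ∀ b d → (b + d) * (b + d) + b * b ≡ 2 * ((b + d) * b) + d * d
  expand = solve-∀

sum-product : ∀ {m n} (f : Fin m → ℕ) (g : Fin n → ℕ) →
              sum f * sum g ≡ sum (λ i → sum (λ j → f i * g j))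
sum-product f g = ≡.trans (*-distribʳ-sum (sum g) f) (sum-cong-≗ (λ i → *-distribˡ-sum (f i) g))

-- Here β is the indicator of a set outside which f vanishes. Doubling makes both double sums
-- symmetric in i and j, so that 2ab ≤ a² + b² can be applied to each term; a term with i or j
-- outside the set has left side 0.
cauchy-schwarz : ∀ {n} (β f : Fin n → ℕ) → (∀ i → β i ≡ 0 ⊎ β i ≡ 1) → (∀ i → β i * f i ≡ f i) →
                 sum f * sum f ≤ sum β * sum (λ i → f i * f i)
cauchy-schwarz {n} β f β01 βf = ℕₚ.*-cancelˡ-≤ 2 (begin
  2 * (sum f * sum f)
    ≡⟨ ≡.cong (2 *_) (sum-product f f) ⟩
  2 * sum (λ i → sum (λ j → f i * f j))
    ≡⟨ ≡.trans (*-distribˡ-sum 2 (λ i → sum (λ j → f i * f j)))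
          (sum-cong-≗ {n} (λ i → *-distribˡ-sum 2 (λ j → f i * f j))) ⟩
  sum (λ i → sum (λ j → 2 * (f i * f j)))
    ≤⟨ sum-mono (λ i → sum-mono (λ j → term i j)) ⟩
  sum (λ i → sum (λ j → f i * f i * β j + β i * (f j * f j)))
    ≡⟨ sum-cong-≗ (λ i → ∑-distrib-+ (λ j → f i * f i * β j) (λ j → β i * (f j * f j))) ⟩
  sum (λ i → sum (λ j → f i * f i * β j) + sum (λ j → β i * (f j * f j)))
    ≡⟨ ∑-distrib-+ (λ i → sum (λ j → f i * f i * β j)) (λ i → sum (λ j → β i * (f j * f j))) ⟩
  sum (λ i → sum (λ j → f i * f i * β j)) + sum (λ i → sum (λ j → β i * (f j * f j)))
    ≡⟨ ≡.cong₂ _+_ (sum-product (λ i → f i * f i) β) (sum-product β (λ j → f j * f j)) ⟨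
  S * sum β + sum β * S
    ≡⟨ double S (sum β) ⟩
  2 * (sum β * S) ∎)
  where
  open ℕₚ.≤-Reasoning
  S = sum (λ i → f i * f i)
  double : ∀ s b → s * b + b * s ≡ 2 * (b * s)
  double = solve-∀
  zeroSq : ∀ i → β i ≡ 0 → f i ≡ 0
  zeroSq i b≡0 = ≡.trans (≡.sym (βf i)) (≡.cong (_* f i) b≡0)
  term : ∀ i j → 2 * (f i * f j) ≤ f i * f i * β j + β i * (f j * f j)
  term i j with β01 i | β01 j
  ... | inj₁ bi | _ = ≡.subst (λ t → 2 * (t * f j) ≤ f i * f i * β j + β i * (f j * f j)) (≡.sym (zeroSq i bi)) z≤n
  ... | inj₂ _  | inj₁ bj = ≡.subst (λ t → 2 * t ≤ f i * f i * β j + β i * (f j * f j))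
          (≡.sym (≡.trans (≡.cong (f i *_) (zeroSq j bj)) (ℕₚ.*-zeroʳ (f i)))) z≤n
  ... | inj₂ bi | inj₂ bj = ≡.subst₂ (λ s t → 2 * (f i * f j) ≤ f i * f i * s + t * (f j * f j))
          (≡.sym bj) (≡.sym bi)
          (≡.subst₂ (λ s t → 2 * (f i * f j) ≤ s + t)
            (≡.sym (ℕₚ.*-identityʳ (f i * f i))) (≡.sym (ℕₚ.*-identityˡ (f j * f j)))
            (2ab≤a²+b² (f i) (f j)))

-- The field comes with an arbitrary equivalence `≈` and no decision procedure; comparing indices in
-- the enumeration decides it.
record FiniteSetoid c ℓ : Set (Level.suc (c ⊔ ℓ)) where
  field
    setoid     : Setoid c ℓ
    size       : ℕ
    element    : Fin size → Setoid.Carrier setoid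
    injective  : ∀ i j → Setoid._≈_ setoid (element i) (element j) → i ≡ j
    surjective : ∀ x → ∃ λ i → Setoid._≈_ setoid (element i) x

  open Setoid setoid public

  index : Carrier → Fin size
  index x = proj₁ (surjective x)

  element-index : ∀ x → element (index x) ≈ x
  element-index x = proj₂ (surjective x)

  infix 4 _≟_
  _≟_ : ∀ x y → Dec (x ≈ y)
  x ≟ y with index x Finₚ.≟ index y
  ... | yes eq = yes (trans (sym (element-index x)) (trans (reflexive (≡.cong element eq)) (element-index y)))
  ... | no neq = no λ x≈y → neq (injective _ _ (trans (element-index x) (trans x≈y (sym (element-index y)))))

  any? : ∀ {p} {P : Carrier → Set p} → (∀ {x y} → x ≈ y → P x → P y) →
         (∀ x → Dec (P x)) → Dec (∃ P)
  any? resp P? with Finₚ.any? (P? ∘ element)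
  ... | yes (i , pi) = yes (element i , pi)
  ... | no ¬any = no λ (x , px) → ¬any (index x , resp (sym (element-index x)) px)

  module _ {d ℓ′} (M : CommutativeMonoid d ℓ′) where
    private module M = CommutativeMonoid M
    open MonoidSum M using () renaming (sum to sumᴹ; sum-permute to sumᴹ-permute; sum-cong-≋ to sumᴹ-cong)

    -- A bijection of the setoid induces a permutation of the indices. The monoid is arbitrary
    -- because sums in ℕ, sums in the field and products in the field are all reindexed this way.
    sum-bijection : (g : Carrier → M.Carrier) → (∀ {x y} → x ≈ y → g x M.≈ g y) →
      (T T⁻¹ : Carrier → Carrier) → (∀ {x y} → x ≈ y → T x ≈ T y) →
      (∀ {x y} → x ≈ y → T⁻¹ x ≈ T⁻¹ y) → (∀ x → T (T⁻¹ x) ≈ x) → (∀ x → T⁻¹ (T x) ≈ x) →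
      sumᴹ (g ∘ T ∘ element) M.≈ sumᴹ (g ∘ element)
    sum-bijection g g-cong T T⁻¹ T-cong T⁻¹-cong TT⁻¹ T⁻¹T =
      M.sym (M.trans (sumᴹ-permute (g ∘ element) π)
        (sumᴹ-cong (λ i → g-cong (element-index (T (element i))))))
      where
      inverse : ∀ (A B : Carrier → Carrier) → (∀ {x y} → x ≈ y → A x ≈ A y) → (∀ x → A (B x) ≈ x) →
                ∀ i → index (A (element (index (B (element i))))) ≡ i
      inverse A B A-cong AB i = injective _ _
        (trans (element-index _) (trans (A-cong (element-index _)) (AB (element i))))
      π = Perm.permutation (index ∘ T ∘ element) (index ∘ T⁻¹ ∘ element)
        (inverse T T⁻¹ T-cong TT⁻¹) (inverse T⁻¹ T T⁻¹-cong T⁻¹T)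

opaque
  ∑ : ∀ {c ℓ} (X : FiniteSetoid c ℓ) → (FiniteSetoid.Carrier X → ℕ) → ℕ
  ∑ X g = sum (g ∘ FiniteSetoid.element X)

infix 5 ∑-syntax
∑-syntax : ∀ {c ℓ} (X : FiniteSetoid c ℓ) → (FiniteSetoid.Carrier X → ℕ) → ℕ
∑-syntax = ∑
syntax ∑-syntax X (λ x → t) = ∑[ x ∈ X ] t

opaque
  unfolding ∑

  ∑-swap : ∀ {c ℓ c′ ℓ′} (X : FiniteSetoid c ℓ) (Y : FiniteSetoid c′ ℓ′)
    (g : FiniteSetoid.Carrier X → FiniteSetoid.Carrier Y → ℕ) →
    ∑ X (λ x → ∑ Y (g x)) ≡ ∑ Y (λ y → ∑ X (λ x → g x y))
  ∑-swap X Y g = ∑-comm (λ i j → g (FiniteSetoid.element X i) (FiniteSetoid.element Y j))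

module _ {c ℓ} (X : FiniteSetoid c ℓ) where
  open FiniteSetoid X
  opaque
    unfolding ∑

    ∑-cong : ∀ {f g : Carrier → ℕ} → (∀ x → f x ≡ g x) → ∑ X f ≡ ∑ X g
    ∑-cong f≡g = sum-cong-≗ (f≡g ∘ element)

    ∑-mono : ∀ {f g : Carrier → ℕ} → (∀ x → f x ≤ g x) → ∑ X f ≤ ∑ X g
    ∑-mono f≤g = sum-mono (f≤g ∘ element)

    ∑-+ : ∀ (f g : Carrier → ℕ) → ∑ X (λ x → f x + g x) ≡ ∑ X f + ∑ X g
    ∑-+ f g = ∑-distrib-+ (f ∘ element) (g ∘ element)

    ∑-*ˡ : ∀ a f → ∑ X (λ x → a * f x) ≡ a * ∑ X f
    ∑-*ˡ a f = ≡.sym (*-distribˡ-sum a (f ∘ element))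

    ∑-const : ∀ a → ∑ X (λ _ → a) ≡ size * a
    ∑-const a = sum-const size a

    ∑-equality : ∀ {f g : Carrier → ℕ} → (∀ {x y} → x ≈ y → f x ≡ f y) → (∀ {x y} → x ≈ y → g x ≡ g y) →
      (∀ x → f x ≤ g x) → ∑ X g ≤ ∑ X f → ∀ x → f x ≡ g x
    ∑-equality f-cong g-cong f≤g Σg≤Σf x = ≡.trans (f-cong (sym (element-index x)))
      (≡.trans (sum-equality (f≤g ∘ element) Σg≤Σf (index x)) (g-cong (element-index x)))

    ∑-indicator : ∀ x → ∑ X (λ y → 𝟙 (y ≟ x)) ≡ 1
    ∑-indicator x = ≡.trans
      (sum-cong-≗ {size} (λ i → 𝟙-cong (element i ≟ x) (i Finₚ.≟ index x)
        (λ eq → injective _ _ (trans eq (sym (element-index x))))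
        (λ eq → trans (reflexive (≡.cong element eq)) (element-index x))))
      (sum-δ (index x))

    ∑-bijection : (g : Carrier → ℕ) → (∀ {x y} → x ≈ y → g x ≡ g y) →
      (T T⁻¹ : Carrier → Carrier) → (∀ {x y} → x ≈ y → T x ≈ T y) →
      (∀ {x y} → x ≈ y → T⁻¹ x ≈ T⁻¹ y) → (∀ x → T (T⁻¹ x) ≈ x) → (∀ x → T⁻¹ (T x) ≈ x) →
      ∑ X (g ∘ T) ≡ ∑ X g
    ∑-bijection = sum-bijection ℕₚ.+-0-commutativeMonoid

    ∑-cauchy-schwarz : ∀ {β f : Carrier → ℕ} → (∀ x → β x ≡ 0 ⊎ β x ≡ 1) → (∀ x → β x * f x ≡ f x) →
                       ∑ X f * ∑ X f ≤ ∑ X β * ∑ X (λ x → f x * f x)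
    ∑-cauchy-schwarz β01 βf = cauchy-schwarz _ _ (β01 ∘ element) (βf ∘ element)

  ∑-zero : ∀ {f : Carrier → ℕ} → (∀ x → f x ≡ 0) → ∑ X f ≡ 0
  ∑-zero f≡0 = ≡.trans (∑-cong f≡0) (≡.trans (∑-const 0) (ℕₚ.*-zeroʳ size))

  ∑-select : ∀ x (g : Carrier → ℕ) → (∀ {x y} → x ≈ y → g x ≡ g y) → ∑ X (λ y → 𝟙 (y ≟ x) * g y) ≡ g x
  ∑-select x g g-cong = ≡.trans (∑-cong pointwise) (≡.trans (∑-*ˡ (g x) (λ y → 𝟙 (y ≟ x)))
    (≡.trans (≡.cong (g x *_) (∑-indicator x)) (ℕₚ.*-identityʳ (g x))))
    where
    pointwise : ∀ y → 𝟙 (y ≟ x) * g y ≡ g x * 𝟙 (y ≟ x)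
    pointwise y with y ≟ x
    ... | yes y≈x = ≡.trans (ℕₚ.*-comm 1 (g y)) (≡.cong (_* 1) (g-cong y≈x))
    ... | no _    = ≡.sym (ℕₚ.*-zeroʳ (g x))

  ∑-unique : ∀ {p} {P : Carrier → Set p} (P? : ∀ y → Dec (P y)) x →
             (∀ y → P y → y ≈ x) → (∀ y → y ≈ x → P y) → ∑ X (λ y → 𝟙 (P? y)) ≡ 1
  ∑-unique P? x to from = ≡.trans (∑-cong (λ y → 𝟙-cong (P? y) (y ≟ x) (to y) (from y))) (∑-indicator x)

-- A ring solver whose coefficients are integers, represented by pairs (a , b) standing for a − b.
module IntegerCoefficients {c ℓ} (F : CommutativeRing c ℓ) where
  open CommutativeRing F renaming (_+_ to _⊕_; _*_ to _⊗_; zero to ⊗-zero)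
  open SemiringMult semiring using (×1-homo-*) renaming (_×_ to _·_; ×-homo-+ to ·-homo-+)
  open RingProperties ring
  open AbelianGroupProperties +-abelianGroup using (⁻¹-∙-comm)
  open SetoidReasoning setoid

  private
    almost = ACR.fromCommutativeRing F
    module Triv = RingSolver (ACR.AlmostCommutativeRing.rawRing almost) almost
      (ACR.-raw-almostCommutative⟶ almost) (λ _ _ → nothing)

    normalise : ℕ × ℕ → ℕ × ℕ
    normalise (a , b) = a ∸ b , b ∸ a

    value : ℕ × ℕ → Carrier
    value (a , b) = a · 1# - b · 1#

    value-normalise : ∀ a b → value (normalise (a , b)) ≈ value (a , b)
    value-normalise zero    zero    = refl
    value-normalise zero    (suc b) = refl
    value-normalise (suc a) zero    = refl
    value-normalise (suc a) (suc b) = begin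
      value (normalise (a , b)) ≈⟨ value-normalise a b ⟩
      A - B                     ≈⟨ +-congʳ (+-identityˡ A) ⟨
      (0# ⊕ A) - B              ≈⟨ +-congʳ (+-congʳ (-‿inverseʳ 1#)) ⟨
      ((1# - 1#) ⊕ A) - B
        ≈⟨ Triv.solve 4 (λ x y a b → ((x Triv.:+ y) Triv.:+ a) Triv.:- b Triv.:=
             (x Triv.:+ a) Triv.:+ (y Triv.:- b)) refl 1# (- 1#) A B ⟩
      (1# ⊕ A) ⊕ (- 1# - B)     ≈⟨ +-congˡ (⁻¹-∙-comm 1# B) ⟩
      (1# ⊕ A) - (1# ⊕ B)       ∎
      where
      A = a · 1#
      B = b · 1#

    raw : RawRing _ _
    raw = record
      { Carrier = ℕ × ℕ
      ; _≈_ = _≡_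
      ; _+_ = λ (a , b) (c , d) → normalise (a + c , b + d)
      ; _*_ = λ (a , b) (c , d) → normalise (a * c + b * d , a * d + b * c)
      ; -_ = λ (a , b) → b , a
      ; 0# = 0 , 0
      ; 1# = 1 , 0
      }

    homomorphism : raw ACR.-Raw-AlmostCommutative⟶ almost
    homomorphism = record
      { ⟦_⟧ = value
      ; +-homo = λ (a , b) (c , d) → trans (value-normalise (a + c) (b + d)) (trans
          (+-cong (·-homo-+ 1# a c) (-‿cong (·-homo-+ 1# b d)))
          (Triv.solve 4 (λ a b c d → (a Triv.:+ c) Triv.:- (b Triv.:+ d) Triv.:=
             (a Triv.:- b) Triv.:+ (c Triv.:- d)) refl (a · 1#) (b · 1#) (c · 1#) (d · 1#)))
      ; *-homo = λ (a , b) (c , d) → trans (value-normalise (a * c + b * d) (a * d + b * c)) (trans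
          (+-cong (trans (·-homo-+ 1# (a * c) (b * d)) (+-cong (×1-homo-* a c) (×1-homo-* b d)))
            (-‿cong (trans (·-homo-+ 1# (a * d) (b * c)) (+-cong (×1-homo-* a d) (×1-homo-* b c)))))
          (product (a · 1#) (b · 1#) (c · 1#) (d · 1#)))
      ; -‿homo = λ (a , b) → sym (trans (sym (⁻¹-∙-comm (a · 1#) (- (b · 1#))))
          (trans (+-comm _ _) (+-congʳ (-‿involutive (b · 1#)))))
      ; 0-homo = -‿inverseʳ 0#
      ; 1-homo = trans (+-cong (+-identityʳ 1#) -0#≈0#) (+-identityʳ 1#)
      }
      where
      product : ∀ a b c d → (a ⊗ c ⊕ b ⊗ d) - (a ⊗ d ⊕ b ⊗ c) ≈ (a - b) ⊗ (c - d)
      product a b c d = begin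
        (a ⊗ c ⊕ b ⊗ d) - (a ⊗ d ⊕ b ⊗ c)
          ≈⟨ +-cong (+-congˡ (trans (sym (-‿involutive _)) (trans (-‿cong (-‿distribʳ-* b d)) (-‿distribˡ-* b (- d)))))
              (trans (sym (⁻¹-∙-comm _ _)) (+-cong (-‿distribʳ-* a d) (-‿distribˡ-* b c))) ⟩
        (a ⊗ c ⊕ (- b) ⊗ (- d)) ⊕ (a ⊗ (- d) ⊕ (- b) ⊗ c)
          ≈⟨ Triv.solve 4 (λ a b c d → (a Triv.:* c Triv.:+ b Triv.:* d) Triv.:+ (a Triv.:* d Triv.:+ b Triv.:* c)
              Triv.:= (a Triv.:+ b) Triv.:* (c Triv.:+ d)) refl a (- b) c (- d) ⟩
        (a - b) ⊗ (c - d) ∎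

    coefficient≟ : ∀ x y → Maybe (value x ≈ value y)
    coefficient≟ (a , b) (c , d) with a ℕₚ.≟ c | b ℕₚ.≟ d
    ... | yes ≡.refl | yes ≡.refl = just refl
    ... | _          | _          = nothing

  open RingSolver raw almost homomorphism coefficient≟ public
    using (solve; _:=_; _:+_; _:*_; _:-_; :-_)

-- Finite fields

-- The absorption identity, kept as a product because Euclid's lemma is to be applied to it. It
-- follows from Pascal's rule by induction.
C-absorption : ∀ n k → suc k * (suc n C suc k) ≡ suc n * (n C k)
C-absorption zero zero = ≡.refl
C-absorption zero (suc k) = ≡.trans
  (≡.cong (suc (suc k) *_) (k>n⇒nCk≡0 {1} {suc (suc k)} (s≤s (s≤s z≤n))))
  (≡.trans (ℕₚ.*-zeroʳ (suc (suc k))) (≡.sym (≡.cong (1 *_) (k>n⇒nCk≡0 {0} {suc k} (s≤s z≤n)))))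
C-absorption (suc n) zero = ≡.trans (ℕₚ.*-identityˡ _)
  (≡.trans (nC1≡n (suc (suc n))) (≡.sym (ℕₚ.*-identityʳ (suc (suc n)))))
C-absorption (suc n) (suc k) = begin
  suc (suc k) * (suc (suc n) C suc (suc k))
    ≡⟨ ≡.cong (suc (suc k) *_) (nCk+nC[k+1]≡[n+1]C[k+1] (suc n) (suc k)) ⟨
  suc (suc k) * (A + B)                   ≡⟨ split k A B ⟩
  A + (suc k * A + suc (suc k) * B)
    ≡⟨ ≡.cong (A +_) (≡.cong₂ _+_ (C-absorption n k) (C-absorption n (suc k))) ⟩
  A + (suc n * (n C k) + suc n * (n C suc k))
    ≡⟨ ≡.cong (A +_) (ℕₚ.*-distribˡ-+ (suc n) (n C k) (n C suc k)) ⟨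
  A + suc n * (n C k + n C suc k)
    ≡⟨ ≡.cong (λ t → A + suc n * t) (nCk+nC[k+1]≡[n+1]C[k+1] n k) ⟩
  A + suc n * A                           ∎
  where
  open ≡.≡-Reasoning
  A = suc n C suc k
  B = suc n C suc (suc k)
  split : ∀ k a b → suc (suc k) * (a + b) ≡ a + (suc k * a + suc (suc k) * b)
  split = solve-∀

prime∣C : ∀ {p} → Prime (suc p) → ∀ {k} → suc k < suc p → suc p ∣ suc p C suc k
prime∣C {p} isPrime {k} k<p with euclidsLemma (suc k) (suc p C suc k) isPrime
  (divides (p C k) (≡.trans (C-absorption p k) (ℕₚ.*-comm (suc p) (p C k))))
... | inj₁ p∣k = ⊥-elim (>⇒∤ k<p p∣k)
... | inj₂ p∣C = p∣C

module FiniteField {c ℓ} (F : CommutativeRing c ℓ) (isField : IsField F)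
  {N : ℕ} (card : HasCardinality F N) where

  open CommutativeRing F public renaming (_+_ to _⊕_; _*_ to _⊗_; zero to ⊗-zero)
  open SemiringMult semiring public using (×1-homo-*) renaming
    (_×_ to _·_; ×-homo-+ to ·-homo-+; ×-congʳ to ·-congʳ; ×-assoc-* to ·-assoc-⊗)
  open SemiringExp semiring public renaming (_^_ to _↑_; ^-congˡ to ↑-congˡ;
      ^-assocʳ to ↑-assocʳ; ^-congʳ to ↑-congʳ)
  open CommutativeSemiringExp commutativeSemiring public using () renaming (^-distrib-* to ↑-distrib-⊗)
  open RingProperties ring public using (-‿distribˡ-*; -‿distribʳ-*; -‿involutive; -0#≈0#;
      x∙y⁻¹≈ε⇒x≈y; +-inverseˡ-unique)
  open IntegerCoefficients F public
  private
    module R = SetoidReasoning setoid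
    module FΣ = SemiringSum semiring
    module FΠ = MonoidSum *-commutativeMonoid

  finiteField : FiniteSetoid c ℓ
  finiteField = record
    { setoid = setoid ; size = N ; element = proj₁ card
    ; injective = proj₁ (proj₂ card) ; surjective = proj₂ (proj₂ card) }

  open FiniteSetoid finiteField public using (_≟_; element)

  1≉0 : ¬ (1# ≈ 0#)
  1≉0 = proj₁ isField

  inverse : ∀ x → ¬ (x ≈ 0#) → ∃ λ y → x ⊗ y ≈ 1#
  inverse = proj₂ isField

  no-zero-divisors : ∀ {x y} → ¬ (x ≈ 0#) → x ⊗ y ≈ 0# → y ≈ 0#
  no-zero-divisors {x} {y} x≉0 xy≈0 with inverse x x≉0
  ... | z , xz≈1 = begin
    y             ≈⟨ *-identityˡ y ⟨
    1# ⊗ y        ≈⟨ *-congʳ xz≈1 ⟨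
    (x ⊗ z) ⊗ y   ≈⟨ solve 3 (λ x y z → (x :* z) :* y := z :* (x :* y)) refl x y z ⟩
    z ⊗ (x ⊗ y)   ≈⟨ *-congˡ xy≈0 ⟩
    z ⊗ 0#        ≈⟨ zeroʳ z ⟩
    0#            ∎
    where open R

  ⊗-≉0 : ∀ {x y} → ¬ (x ≈ 0#) → ¬ (y ≈ 0#) → ¬ (x ⊗ y ≈ 0#)
  ⊗-≉0 x≉0 y≉0 xy≈0 = y≉0 (no-zero-divisors x≉0 xy≈0)

  ↑-zero : ∀ {x} n → x ↑ n ≈ 0# → x ≈ 0#
  ↑-zero zero    1≈0 = ⊥-elim (1≉0 1≈0)
  ↑-zero {x} (suc n) eq with x ≟ 0#
  ... | yes x≈0 = x≈0
  ... | no  x≉0 = ↑-zero n (no-zero-divisors x≉0 eq)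

  x⊕y≈y⇒x≈0 : ∀ {x y} → x ⊕ y ≈ y → x ≈ 0#
  x⊕y≈y⇒x≈0 {x} {y} eq = R.begin
    x           R.≈⟨ solve 2 (λ x y → x := (x :+ y) :- y) refl x y ⟩
    (x ⊕ y) - y R.≈⟨ +-congʳ eq ⟩
    y - y       R.≈⟨ -‿inverseʳ y ⟩
    0#          R.∎

  -- Translating by 1 permutes the field, hence does not change the sum of its elements.
  N·1≈0 : N · 1# ≈ 0#
  N·1≈0 = x⊕y≈y⇒x≈0 (R.begin
    N · 1# ⊕ FΣ.sum element
      R.≈⟨ +-congʳ (FΣ.sum-replicate N) ⟨
    FΣ.sum {N} (λ _ → 1#) ⊕ FΣ.sum element
      R.≈⟨ FΣ.∑-distrib-+ (λ _ → 1#) element ⟨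
    FΣ.sum (λ i → 1# ⊕ element i)
      R.≈⟨ FiniteSetoid.sum-bijection finiteField
            +-commutativeMonoid (λ x → x) (λ eq → eq) (1# ⊕_) (λ x → x - 1#)
            +-congˡ +-congʳ
            (λ x → solve 2 (λ a x → a :+ (x :- a) := x) refl 1# x)
            (λ x → solve 2 (λ a x → (a :+ x) :- a := x) refl 1# x) ⟩
    FΣ.sum element R.∎)

  private
    -- Replaces the factor belonging to x = 0 by 1, so that a product over the nonzero elements
    -- becomes a product over the whole enumeration.
    unit : Carrier → Carrier → Carrier
    unit a x with x ≟ 0#
    ... | yes _ = 1#
    ... | no  _ = a

    unit-0 : ∀ {a x} → x ≈ 0# → unit a x ≈ 1#
    unit-0 {a} {x} x≈0 with x ≟ 0#
    ... | yes _ = refl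
    ... | no x≉0 = ⊥-elim (x≉0 x≈0)

    unit-≉0 : ∀ {a x} → ¬ (x ≈ 0#) → unit a x ≈ a
    unit-≉0 {a} {x} x≉0 with x ≟ 0#
    ... | yes x≈0 = ⊥-elim (x≉0 x≈0)
    ... | no _ = refl

    product-≉0 : ∀ {n} (f : Fin n → Carrier) → (∀ i → ¬ (f i ≈ 0#)) → ¬ (FΠ.sum f ≈ 0#)
    product-≉0 {zero}  f f≉0 = 1≉0
    product-≉0 {suc n} f f≉0 = ⊗-≉0 (f≉0 zero) (product-≉0 (f ∘ suc) (f≉0 ∘ suc))

    -- Exactly one of the n + 1 indices carries zero, which leaves the exponent n.
    product-unit : ∀ a {n} (f : Fin (suc n) → Carrier) (i₀ : Fin (suc n)) → f i₀ ≈ 0# →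
      (∀ i → ¬ (f (punchIn i₀ i) ≈ 0#)) → FΠ.sum (unit a ∘ f) ≈ a ↑ n
    product-unit a {n} f i₀ f₀ f≉0 = R.begin
      FΠ.sum (unit a ∘ f)
        R.≈⟨ FΠ.sum-remove {n} {i₀} (unit a ∘ f) ⟩
      unit a (f i₀) ⊗ FΠ.sum (λ i → unit a (f (punchIn i₀ i)))
        R.≈⟨ *-cong (unit-0 f₀) (FΠ.sum-cong-≋ (λ i → unit-≉0 (f≉0 i))) ⟩
      1# ⊗ FΠ.sum {n} (λ _ → a)
        R.≈⟨ trans (*-identityˡ _) (FΠ.sum-replicate n) ⟩
      a ↑ n R.∎

  -- Multiplying by a permutes the nonzero elements, so their product is fixed by a ↑ (N − 1).
  units-order : ∀ {n} (f : Fin n → Carrier) →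
    (∀ i j → f i ≈ f j → i ≡ j) → (∀ x → ∃ λ i → f i ≈ x) → ∀ a → a ↑ n ≈ a
  units-order {zero} f inj sur a with sur a
  ... | () , _
  units-order {suc n} f inj sur a with a ≟ 0#
  ... | yes a≈0 = trans (*-congʳ a≈0) (trans (zeroˡ _) (sym a≈0))
  ... | no a≉0 with inverse a a≉0
  ... | b , ab≈1 = trans (*-congˡ a↑n≈1) (*-identityʳ a)
    where
    open R
    enumerated : FiniteSetoid c ℓ
    enumerated = record { setoid = setoid ; size = suc n ; element = f ; injective = inj ; surjective = sur }
    module E′ = FiniteSetoid enumerated
    value : Carrier → Carrier
    value x = unit x x
    value-cong : ∀ {x y} → x ≈ y → value x ≈ value y
    value-cong {x} {y} x≈y = case (x ≟ 0#)
      where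
      case : Dec (x ≈ 0#) → value x ≈ value y
      case (yes x≈0) = trans (unit-0 x≈0) (sym (unit-0 (trans (sym x≈y) x≈0)))
      case (no x≉0) = trans (unit-≉0 x≉0) (trans x≈y (sym (unit-≉0 (x≉0 ∘ trans x≈y))))
    value-≉0 : ∀ x → ¬ (value x ≈ 0#)
    value-≉0 x eq with x ≟ 0#
    ... | yes _ = 1≉0 eq
    ... | no x≉0 = x≉0 eq
    value-⊗ : ∀ x → value (a ⊗ x) ≈ unit a x ⊗ value x
    value-⊗ x = case (x ≟ 0#)
      where
      case : Dec (x ≈ 0#) → value (a ⊗ x) ≈ unit a x ⊗ value x
      case (yes x≈0) = trans (unit-0 (trans (*-congˡ x≈0) (zeroʳ a)))
        (sym (trans (*-cong (unit-0 x≈0) (unit-0 x≈0)) (*-identityˡ 1#)))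
      case (no x≉0) = trans (unit-≉0 (⊗-≉0 a≉0 x≉0)) (sym (*-cong (unit-≉0 x≉0) (unit-≉0 x≉0)))
    Π = FΠ.sum (value ∘ f)
    aΠ≈Π : a ↑ n ⊗ Π ≈ Π
    aΠ≈Π = begin
      a ↑ n ⊗ Π
        ≈⟨ *-congʳ (product-unit a f (E′.index 0#) (E′.element-index 0#)
             (λ i eq → Finₚ.punchInᵢ≢i (E′.index 0#) i (inj _ _ (trans eq (sym (E′.element-index 0#)))))) ⟨
      FΠ.sum (unit a ∘ f) ⊗ Π               ≈⟨ FΠ.∑-distrib-+ (unit a ∘ f) (value ∘ f) ⟨
      FΠ.sum (λ i → unit a (f i) ⊗ value (f i)) ≈⟨ FΠ.sum-cong-≋ (λ i → value-⊗ (f i)) ⟨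
      FΠ.sum (λ i → value (a ⊗ f i))
        ≈⟨ E′.sum-bijection *-commutativeMonoid value value-cong (a ⊗_) (b ⊗_) *-congˡ *-congˡ
             (λ x → cancel x)
                 (λ x → trans (solve 3 (λ a b x → b :* (a :* x) := a :* (b :* x)) refl a b x) (cancel x)) ⟩
      Π ∎
      where
      cancel : ∀ x → a ⊗ (b ⊗ x) ≈ x
      cancel x = trans (sym (*-assoc a b x)) (trans (*-congʳ ab≈1) (*-identityˡ x))
    a↑n≈1 : a ↑ n ≈ 1#
    a↑n≈1 = x∙y⁻¹≈ε⇒x≈y _ _ (no-zero-divisors (product-≉0 (value ∘ f) (value-≉0 ∘ f)) (begin
      Π ⊗ (a ↑ n - 1#)
        ≈⟨ solve 3 (λ P u o → P :* (u :- o) := u :* P :- o :* P) refl Π (a ↑ n) 1# ⟩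
      a ↑ n ⊗ Π - 1# ⊗ Π ≈⟨ +-cong aΠ≈Π (-‿cong (*-identityˡ Π)) ⟩
      Π - Π              ≈⟨ -‿inverseʳ Π ⟩
      0# ∎))

  x↑N≈x : ∀ x → x ↑ N ≈ x
  x↑N≈x = units-order element (proj₁ (proj₂ card)) (proj₂ (proj₂ card))

  -- The element p^j · 1 is the j-th power of p · 1, and a field has no nilpotent elements other
  -- than 0.
  prime-characteristic : ∀ p j → (p ^ j) · 1# ≈ 0# → p · 1# ≈ 0#
  prime-characteristic p zero eq = ⊥-elim (1≉0 (trans (sym (+-identityʳ 1#)) eq))
  prime-characteristic p (suc j) eq with (p · 1#) ≟ 0#
  ... | yes p≈0 = p≈0
  ... | no  p≉0 = prime-characteristic p j
    (no-zero-divisors p≉0 (trans (sym (×1-homo-* p (p ^ j))) eq))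

  multiple·≈0 : ∀ {p} → p · 1# ≈ 0# → ∀ {m} → p ∣ m → ∀ x → m · x ≈ 0#
  multiple·≈0 {p} p≈0 (divides d ≡.refl) x = begin
    (d * p) · x          ≈⟨ ·-congʳ (d * p) (*-identityˡ x) ⟨
    (d * p) · (1# ⊗ x)   ≈⟨ ·-assoc-⊗ (d * p) 1# x ⟨
    ((d * p) · 1#) ⊗ x   ≈⟨ *-congʳ (×1-homo-* d p) ⟩
    (d · 1# ⊗ p · 1#) ⊗ x ≈⟨ *-congʳ (trans (*-congˡ p≈0) (zeroʳ _)) ⟩
    0# ⊗ x               ≈⟨ zeroˡ x ⟩
    0#                   ∎
    where open R

  -- The inner binomial coefficients are multiples of p and vanish; only the two extreme terms of
  -- the expansion remain.
  freshman : ∀ {p} → Prime p → p · 1# ≈ 0# → ∀ x y → (x ⊕ y) ↑ p ≈ x ↑ p ⊕ y ↑ p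
  freshman {zero} isPrime with prime⇒nonZero isPrime
  ... | ()
  freshman {suc p} isPrime p≈0 x y = begin
    (x ⊕ y) ↑ suc p
      ≈⟨ BT.theorem (suc p) x y ⟩
    term zero ⊕ FΣ.sum (λ i → term (suc i))
      ≈⟨ +-cong first (FΣ.sum-init-last (λ i → term (suc i))) ⟩
    y ↑ suc p ⊕ (FΣ.sum (λ i → term (suc (inject₁ i))) ⊕ term (suc (fromℕ p)))
      ≈⟨ +-congˡ (+-cong (trans (FΣ.sum-cong-≋ middle) (FΣ.sum-replicate-zero p)) last) ⟩
    y ↑ suc p ⊕ (0# ⊕ x ↑ suc p)
      ≈⟨ trans (+-congˡ (+-identityˡ _)) (+-comm _ _) ⟩
    x ↑ suc p ⊕ y ↑ suc p ∎
    where
    open R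
    module BT = BinomialTheorem commutativeSemiring
    term = BT.binomialTerm x y (suc p)
    first : term zero ≈ y ↑ suc p
    first = trans (+-identityʳ _) (*-identityˡ _)
    middle : ∀ i → term (suc (inject₁ i)) ≈ 0#
    middle i = multiple·≈0 p≈0
      (prime∣C isPrime (s≤s (≡.subst (_< p) (≡.sym (Finₚ.toℕ-inject₁ i)) (Finₚ.toℕ<n i)))) _
    last : term (suc (fromℕ p)) ≈ x ↑ suc p
    last rewrite Finₚ.toℕ-fromℕ p | nCn≡1 (suc p) | ℕₚ.n∸n≡0 p =
      trans (+-identityʳ _) (*-identityʳ _)

  freshman-power : ∀ {p} → Prime p → p · 1# ≈ 0# → ∀ e x y →
                   (x ⊕ y) ↑ (p ^ e) ≈ x ↑ (p ^ e) ⊕ y ↑ (p ^ e)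
  freshman-power isPrime p≈0 zero x y =
    trans (*-identityʳ _) (sym (+-cong (*-identityʳ x) (*-identityʳ y)))
  freshman-power {p} isPrime p≈0 (suc e) x y = begin
    (x ⊕ y) ↑ (p * p ^ e)                    ≈⟨ ↑-assocʳ (x ⊕ y) p (p ^ e) ⟨
    ((x ⊕ y) ↑ p) ↑ (p ^ e)                  ≈⟨ ↑-congˡ (p ^ e) (freshman isPrime p≈0 x y) ⟩
    (x ↑ p ⊕ y ↑ p) ↑ (p ^ e)                ≈⟨ freshman-power isPrime p≈0 e _ _ ⟩
    (x ↑ p) ↑ (p ^ e) ⊕ (y ↑ p) ↑ (p ^ e)    ≈⟨ +-cong (↑-assocʳ x p _) (↑-assocʳ y p _) ⟩
    x ↑ (p * p ^ e) ⊕ y ↑ (p * p ^ e)        ∎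
    where open R

  -- The list holds the coefficients below the leading 1, constant term first.
  evalMonic : List Carrier → Carrier → Carrier
  evalMonic []       x = 1#
  evalMonic (c ∷ cs) x = c ⊕ x ⊗ evalMonic cs x

  evalMonic-cong : ∀ cs {x y} → x ≈ y → evalMonic cs x ≈ evalMonic cs y
  evalMonic-cong []       x≈y = refl
  evalMonic-cong (c ∷ cs) x≈y = +-congˡ (*-cong x≈y (evalMonic-cong cs x≈y))

  evalMonic-replicate : ∀ n x → evalMonic (replicate n 0#) x ≈ x ↑ n
  evalMonic-replicate zero    x = refl
  evalMonic-replicate (suc n) x = trans (+-identityˡ _) (*-congˡ (evalMonic-replicate n x))

  -- Synthetic division by x - r: the coefficients of the quotient are the Horner tails evaluated at
  -- r. The constant term of the dividend has no influence, so the list passed here starts after it,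
  -- and the leading 1 stays implicit.
  quotient : Carrier → List Carrier → List Carrier
  quotient r []        = []
  quotient r (d ∷ ds) = evalMonic (d ∷ ds) r ∷ quotient r ds

  length-quotient : ∀ r ds → length (quotient r ds) ≡ length ds
  length-quotient r []       = ≡.refl
  length-quotient r (d ∷ ds) = ≡.cong suc (length-quotient r ds)

  division : ∀ r c cs x → evalMonic (c ∷ cs) x - evalMonic (c ∷ cs) r ≈
             (x - r) ⊗ evalMonic (quotient r cs) x
  division r c [] x = solve 4 (λ r c x o → (c :+ x :* o) :- (c :+ r :* o) := (x :- r) :* o) refl r c x 1#
  division r c (d ∷ ds) x = begin
    (c ⊕ x ⊗ p x) - (c ⊕ r ⊗ p r)
      ≈⟨ solve 5 (λ r c x px pr → (c :+ x :* px) :- (c :+ r :* pr) :=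
           x :* (px :- pr) :+ (x :- r) :* pr) refl r c x (p x) (p r) ⟩
    x ⊗ (p x - p r) ⊕ (x - r) ⊗ p r
      ≈⟨ +-congʳ (*-congˡ (division r d ds x)) ⟩
    x ⊗ ((x - r) ⊗ s) ⊕ (x - r) ⊗ p r
      ≈⟨ solve 4 (λ x t s pr → x :* (t :* s) :+ t :* pr := t :* (pr :+ x :* s)) refl x (x - r) s (p r) ⟩
    (x - r) ⊗ (p r ⊕ x ⊗ s) ∎
    where
    open R
    p = evalMonic (d ∷ ds)
    s = evalMonic (quotient r ds) x

  -- Exhaustive search either finds a root r, and division leaves a monic quotient of degree one
  -- less, or there is none. Monicity rules out the zero polynomial.
  root-count : ∀ d cs → length cs ≡ d → (∑[ x ∈ finiteField ] 𝟙 (evalMonic cs x ≟ 0#)) ≤ d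
  root-count zero [] _ = ℕₚ.≤-reflexive (∑-zero finiteField (λ x → 𝟙-no (1# ≟ 0#) 1≉0))
  root-count (suc d) (c ∷ cs) eq
    with FiniteSetoid.any? finiteField (λ x≈y ex → trans (sym (evalMonic-cong (c ∷ cs) x≈y)) ex)
        (λ x → evalMonic (c ∷ cs) x ≟ 0#)
  ... | no ¬root = ℕₚ.≤-trans (ℕₚ.≤-reflexive (∑-zero finiteField
      (λ x → 𝟙-no (evalMonic (c ∷ cs) x ≟ 0#) (λ e → ¬root (x , e))))) z≤n
  ... | yes (r , root) = begin
    ∑[ x ∈ finiteField ] 𝟙 (evalMonic (c ∷ cs) x ≟ 0#)
      ≤⟨ ∑-mono finiteField pointwise ⟩
    ∑[ x ∈ finiteField ] 𝟙 (x ≟ r) + 𝟙 (evalMonic qs x ≟ 0#)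
      ≡⟨ ∑-+ finiteField _ _ ⟩
    (∑[ x ∈ finiteField ] 𝟙 (x ≟ r)) + (∑[ x ∈ finiteField ] 𝟙 (evalMonic qs x ≟ 0#))
      ≤⟨ ℕₚ.+-mono-≤ (ℕₚ.≤-reflexive (∑-indicator finiteField r))
           (root-count d qs (≡.trans (length-quotient r cs) (ℕₚ.suc-injective eq))) ⟩
    suc d ∎
    where
    open ℕₚ.≤-Reasoning
    qs = quotient r cs
    pointwise : ∀ x → 𝟙 (evalMonic (c ∷ cs) x ≟ 0#) ≤ 𝟙 (x ≟ r) + 𝟙 (evalMonic qs x ≟ 0#)
    pointwise x with evalMonic (c ∷ cs) x ≟ 0# | x ≟ r
    ... | no _   | _     = z≤n
    ... | yes _  | yes _ = s≤s z≤n
    ... | yes ex | no x≉r = ℕₚ.≤-reflexive (≡.sym (𝟙-yes (evalMonic qs x ≟ 0#)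
      (no-zero-divisors (x≉r ∘ x∙y⁻¹≈ε⇒x≈y x r) (trans (sym (division r c cs x))
        (trans (+-cong ex (-‿cong root)) (-‿inverseʳ 0#))))))

-- Linear systems over a finite field

funToFin-cong : ∀ {m n} {f g : Fin m → Fin n} → (∀ i → f i ≡ g i) → funToFin f ≡ funToFin g
funToFin-cong {zero}  f≗g = ≡.refl
funToFin-cong {suc m} f≗g = ≡.cong₂ combine (f≗g zero) (funToFin-cong (f≗g ∘ suc))

module Vectors {c ℓ} (F : CommutativeRing c ℓ) (isField : IsField F)
  {N : ℕ} (card : HasCardinality F N) where

  open FiniteField F isField card public
  open VectorEquality setoid public using (_≋_)
  private
    module R = SetoidReasoning setoid
    module FΣ = SemiringSum semiring

  V : ℕ → Set c
  V n = Fin n → Carrier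

  vectorSpace : ℕ → FiniteSetoid c ℓ
  vectorSpace n = record
    { setoid = VectorEquality.≋-setoid setoid n
    ; size = N ^ n
    ; element = λ i → element ∘ finToFun i
    ; injective = λ i j eq → ≡.trans (≡.sym (Finₚ.funToFin-finToFin {n} i))
        (≡.trans (funToFin-cong (λ t → FiniteSetoid.injective finiteField _ _ (eq t))) (Finₚ.funToFin-finToFin {n} j))
    ; surjective = λ x → funToFin (FiniteSetoid.index finiteField ∘ x) , λ t →
        trans (reflexive (≡.cong element (Finₚ.finToFun-funToFin (FiniteSetoid.index finiteField ∘ x) t)))
          (FiniteSetoid.element-index finiteField (x t))
    }

  infix 4 _≟ᵥ_
  _≟ᵥ_ : ∀ {n} (x y : V n) → Dec (x ≋ y)
  _≟ᵥ_ {n} = FiniteSetoid._≟_ (vectorSpace n)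

  0ᵥ : ∀ {n} → V n
  0ᵥ _ = 0#

  infixl 6 _⊞_
  _⊞_ : ∀ {n} → V n → V n → V n
  (x ⊞ y) i = x i ⊕ y i

  infixr 7 _⊡_
  _⊡_ : ∀ {n} → Carrier → V n → V n
  (a ⊡ x) i = a ⊗ x i

  ∑-translate : ∀ {n} (g : V n → ℕ) → (∀ {x y} → x ≋ y → g x ≡ g y) → ∀ t →
                (∑[ x ∈ vectorSpace n ] g (x ⊞ t)) ≡ ∑ (vectorSpace n) g
  ∑-translate {n} g g-cong t = ∑-bijection (vectorSpace n) g g-cong (_⊞ t) (λ x i → x i - t i)
    (λ eq i → +-congʳ (eq i)) (λ eq i → +-congʳ (eq i))
    (λ x i → solve 2 (λ x t → (x :- t) :+ t := x) refl (x i) (t i))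
    (λ x i → solve 2 (λ x t → (x :+ t) :- t := x) refl (x i) (t i))

  dot : ∀ {n} → V n → V n → Carrier
  dot x y = FΣ.sum (λ i → x i ⊗ y i)

  dot-cong : ∀ {n} {x x′ y y′ : V n} → x ≋ x′ → y ≋ y′ → dot x y ≈ dot x′ y′
  dot-cong x≋x′ y≋y′ = FΣ.sum-cong-≋ (λ i → *-cong (x≋x′ i) (y≋y′ i))

  dot-comm : ∀ {n} (x y : V n) → dot x y ≈ dot y x
  dot-comm x y = FΣ.sum-cong-≋ (λ i → *-comm (x i) (y i))

  dot-⊞ : ∀ {n} (x y z : V n) → dot x (y ⊞ z) ≈ dot x y ⊕ dot x z
  dot-⊞ x y z = trans (FΣ.sum-cong-≋ (λ i → distribˡ (x i) (y i) (z i)))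
    (FΣ.∑-distrib-+ (λ i → x i ⊗ y i) (λ i → x i ⊗ z i))

  dot-⊡ : ∀ {n} a (x y : V n) → dot x (a ⊡ y) ≈ a ⊗ dot x y
  dot-⊡ a x y = trans (FΣ.sum-cong-≋ (λ i → solve 3 (λ a x y → x :* (a :* y) := a :* (x :* y)) refl a (x i) (y i)))
    (sym (FΣ.*-distribˡ-sum a (λ i → x i ⊗ y i)))

  dot-0ˡ : ∀ {n} {x : V n} → x ≋ 0ᵥ → ∀ y → dot x y ≈ 0#
  dot-0ˡ {n} x≋0 y = trans (FΣ.sum-cong-≋ (λ i → trans (*-congʳ (x≋0 i)) (zeroˡ (y i)))) (FΣ.sum-replicate-zero n)

  dot-swap : ∀ {k n} (c : V k) (r : Fin k → V n) (x : V n) →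
             dot c (λ i → dot (r i) x) ≈ dot (λ j → dot c (λ i → r i j)) x
  dot-swap c r x = begin
    FΣ.sum (λ i → c i ⊗ dot (r i) x)
      ≈⟨ FΣ.sum-cong-≋ (λ i → FΣ.*-distribˡ-sum (c i) (λ j → r i j ⊗ x j)) ⟩
    FΣ.sum (λ i → FΣ.sum (λ j → c i ⊗ (r i j ⊗ x j)))
      ≈⟨ FΣ.∑-comm (λ i j → c i ⊗ (r i j ⊗ x j)) ⟩
    FΣ.sum (λ j → FΣ.sum (λ i → c i ⊗ (r i j ⊗ x j)))
      ≈⟨ FΣ.sum-cong-≋ (λ j → FΣ.sum-cong-≋ (λ i → *-assoc (c i) (r i j) (x j))) ⟨
    FΣ.sum (λ j → FΣ.sum (λ i → (c i ⊗ r i j) ⊗ x j))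
      ≈⟨ FΣ.sum-cong-≋ (λ j → FΣ.*-distribʳ-sum (x j) (λ i → c i ⊗ r i j)) ⟨
    FΣ.sum (λ j → dot c (λ i → r i j) ⊗ x j) ∎
    where open R

  sumF≡sum : ∀ {m} (f : V m) → sumF F f ≡ FΣ.sum f
  sumF≡sum {zero}  f = ≡.refl
  sumF≡sum {suc m} f = ≡.cong (f zero ⊕_) (sumF≡sum (f ∘ suc))

  unitVector : ∀ {n} → Fin n → V n
  unitVector zero    zero    = 1#
  unitVector zero    (suc j) = 0#
  unitVector (suc i) zero    = 0#
  unitVector (suc i) (suc j) = unitVector i j

  dot-unit : ∀ {n} (x : V n) j → dot x (unitVector j) ≈ x j
  dot-unit {suc n} x zero = trans (+-cong (*-identityʳ (x zero))
    (trans (FΣ.sum-cong-≋ (λ i → zeroʳ (x (suc i)))) (FΣ.sum-replicate-zero n))) (+-identityʳ (x zero))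
  dot-unit {suc n} x (suc j) = trans (+-cong (zeroʳ (x zero)) (dot-unit (x ∘ suc) j)) (+-identityˡ _)

  solve-linear : ∀ {b} → ¬ (b ≈ 0#) → ∀ a → (∑[ x ∈ finiteField ] 𝟙 (a ⊕ x ⊗ b ≟ 0#)) ≡ 1
  solve-linear {b} b≉0 a with inverse b b≉0
  ... | b⁻¹ , bb⁻¹≈1 = ∑-unique finiteField (λ x → a ⊕ x ⊗ b ≟ 0#) (- a ⊗ b⁻¹)
    (λ x eq → begin
      x                            ≈⟨ *-identityʳ x ⟨
      x ⊗ 1#                       ≈⟨ *-congˡ bb⁻¹≈1 ⟨
      x ⊗ (b ⊗ b⁻¹)
        ≈⟨ solve 4 (λ a b c x → x :* (b :* c) := (a :+ x :* b) :* c :- a :* c) refl a b b⁻¹ x ⟩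
      (a ⊕ x ⊗ b) ⊗ b⁻¹ - a ⊗ b⁻¹  ≈⟨ +-congʳ (trans (*-congʳ eq) (zeroˡ b⁻¹)) ⟩
      0# - a ⊗ b⁻¹                 ≈⟨ +-identityˡ _ ⟩
      - (a ⊗ b⁻¹)                  ≈⟨ -‿distribˡ-* a b⁻¹ ⟩
      - a ⊗ b⁻¹                    ∎)
    (λ x eq → begin
      a ⊕ x ⊗ b                    ≈⟨ +-congˡ (*-congʳ eq) ⟩
      a ⊕ (- a ⊗ b⁻¹) ⊗ b          ≈⟨ solve 3 (λ a b c → a :+ (:- a :* c) :* b := a :- a :* (b :* c)) refl a b b⁻¹ ⟩
      a - a ⊗ (b ⊗ b⁻¹)            ≈⟨ +-congˡ (-‿cong (trans (*-congˡ bb⁻¹≈1) (*-identityʳ a))) ⟩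
      a - a                        ≈⟨ -‿inverseʳ a ⟩
      0#                           ∎)
    where open R

  ≟-cong : ∀ {x y} → x ≈ y → 𝟙 (x ≟ 0#) ≡ 𝟙 (y ≟ 0#)
  ≟-cong {x} {y} x≈y = 𝟙-cong (x ≟ 0#) (y ≟ 0#) (trans (sym x≈y)) (trans x≈y)

  -- Choose j with w_j nonzero. On each line x + a e_j the functional is affine in a with slope w_j,
  -- hence vanishes exactly once; summing over all translates by a e_j counts every zero N times.
  hyperplane-count : ∀ {n} (w : V n) → ¬ (w ≋ 0ᵥ) →
                     N * (∑[ x ∈ vectorSpace n ] 𝟙 (dot w x ≟ 0#)) ≡ N ^ n
  hyperplane-count {n} w w≢0 with Finₚ.¬∀⟶∃¬ n _ (λ j → w j ≟ 0#) w≢0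
  ... | j , wj≉0 = begin
    N * (∑[ x ∈ vectorSpace n ] 𝟙 (dot w x ≟ 0#))
      ≡⟨ ∑-const finiteField _ ⟨
    (∑[ a ∈ finiteField ] ∑[ x ∈ vectorSpace n ] 𝟙 (dot w x ≟ 0#))
      ≡⟨ ∑-cong finiteField (λ a → ∑-translate (λ x → 𝟙 (dot w x ≟ 0#))
           (λ eq → ≟-cong (dot-cong (λ _ → refl) eq)) (a ⊡ unitVector j)) ⟨
    (∑[ a ∈ finiteField ] ∑[ x ∈ vectorSpace n ] 𝟙 (dot w (x ⊞ a ⊡ unitVector j) ≟ 0#))
      ≡⟨ ∑-swap finiteField (vectorSpace n) _ ⟩
    (∑[ x ∈ vectorSpace n ] ∑[ a ∈ finiteField ] 𝟙 (dot w (x ⊞ a ⊡ unitVector j) ≟ 0#))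
      ≡⟨ ∑-cong (vectorSpace n) (λ x → ≡.trans
           (∑-cong finiteField (λ a → ≟-cong (trans (dot-⊞ w x _)
             (+-congˡ (trans (dot-⊡ a w _) (*-congˡ (dot-unit w j)))))))
           (solve-linear wj≉0 (dot w x))) ⟩
    (∑[ x ∈ vectorSpace n ] 1)
      ≡⟨ ≡.trans (∑-const (vectorSpace n) 1) (ℕₚ.*-identityʳ _) ⟩
    N ^ n ∎
    where open ≡.≡-Reasoning

  module _ {N′} (N≡ : N ≡ suc N′) where

    -- One formula for w = 0 and w ≠ 0, with `N′` = N - 1. It plays the part that orthogonality of
    -- characters would play.
    annihilator-count : ∀ {n} (w : V n) →
      N * (∑[ x ∈ vectorSpace n ] 𝟙 (dot w x ≟ 0#)) ≡ N ^ n * (1 + N′ * 𝟙 (w ≟ᵥ 0ᵥ))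
    annihilator-count {n} w with w ≟ᵥ 0ᵥ
    ... | no w≢0 = ≡.trans (hyperplane-count w w≢0)
      (≡.sym (≡.trans (≡.cong (λ t → N ^ n * (1 + t)) (ℕₚ.*-zeroʳ N′)) (ℕₚ.*-identityʳ (N ^ n))))
    ... | yes w≋0 = begin
      N * (∑[ x ∈ vectorSpace n ] 𝟙 (dot w x ≟ 0#))
        ≡⟨ ≡.cong (N *_) (∑-cong (vectorSpace n) (λ x → 𝟙-yes (dot w x ≟ 0#) (dot-0ˡ w≋0 x))) ⟩
      N * (∑[ x ∈ vectorSpace n ] 1)
        ≡⟨ ≡.cong (N *_) (≡.trans (∑-const (vectorSpace n) 1) (ℕₚ.*-identityʳ _)) ⟩
      N * N ^ n           ≡⟨ ℕₚ.*-comm N (N ^ n) ⟩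
      N ^ n * N           ≡⟨ ≡.cong (N ^ n *_) (≡.trans N≡ (≡.cong suc (≡.sym (ℕₚ.*-identityʳ N′)))) ⟩
      N ^ n * (1 + N′ * 1) ∎
      where open ≡.≡-Reasoning

    weighted-count : ∀ {k} (δ : V k → ℕ) a →
      (∑[ x ∈ vectorSpace k ] a * (1 + N′ * δ x)) ≡ a * (N ^ k + N′ * ∑ (vectorSpace k) δ)
    weighted-count {k} δ a = ≡.trans (∑-*ˡ (vectorSpace k) a _) (≡.cong (a *_)
      (≡.trans (∑-+ (vectorSpace k) (λ _ → 1) (λ x → N′ * δ x))
        (≡.cong₂ _+_ (≡.trans (∑-const (vectorSpace k) 1) (ℕₚ.*-identityʳ _)) (∑-*ˡ (vectorSpace k) N′ δ))))

    -- Count the pairs (c , x) with Σᵢ cᵢ (rᵢ · x) = 0, first for fixed c and then for fixed x.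
    solution-count : 1 ≤ N′ → ∀ {k n} (r : Fin k → V n) → LinIndep F r →
      (∑[ x ∈ vectorSpace n ] 𝟙 ((λ i → dot (r i) x) ≟ᵥ 0ᵥ)) * N ^ k ≡ N ^ n
    solution-count (s≤s {n = N″} _) {k} {n} r independent =
      -- Both ways of counting, multiplied by N, contain N^n · N^k. Removing it leaves N^n · N′ = K
      -- · N^k · N′, and N′ is nonzero.
      ≡.sym (ℕₚ.*-cancelʳ-≡ (N ^ n) (K * N ^ k) N′ (ℕₚ.+-cancelˡ-≡ (N ^ n * N ^ k) _ _ (begin
        N ^ n * N ^ k + N ^ n * N′   ≡⟨ expand (N ^ n) (N ^ k) N′ ⟩
        N ^ n * (N ^ k + N′ * 1)     ≡⟨ ≡.cong (λ t → N ^ n * (N ^ k + N′ * t)) (∑-indicator (vectorSpace k) 0ᵥ) ⟨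
        N ^ n * (N ^ k + N′ * (∑[ c ∈ vectorSpace k ] 𝟙 (c ≟ᵥ 0ᵥ)))
          ≡⟨ weighted-count (λ c → 𝟙 (c ≟ᵥ 0ᵥ)) (N ^ n) ⟨
        (∑[ c ∈ vectorSpace k ] N ^ n * (1 + N′ * 𝟙 (c ≟ᵥ 0ᵥ)))
          ≡⟨ ∑-cong (vectorSpace k) (λ c → ≡.cong (λ t → N ^ n * (1 + N′ * t))
               (𝟙-cong (c ≟ᵥ 0ᵥ) (combination c ≟ᵥ 0ᵥ) (λ c≋0 j → dot-0ˡ c≋0 _)
                 (λ eq → independent c (λ j → trans (reflexive (sumF≡sum (λ i → c i ⊗ r i j))) (eq j))))) ⟩
        (∑[ c ∈ vectorSpace k ] N ^ n * (1 + N′ * 𝟙 (combination c ≟ᵥ 0ᵥ)))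
          ≡⟨ ∑-cong (vectorSpace k) (λ c → annihilator-count (combination c)) ⟨
        (∑[ c ∈ vectorSpace k ] N * (∑[ x ∈ vectorSpace n ] 𝟙 (dot (combination c) x ≟ 0#)))
          ≡⟨ ∑-*ˡ (vectorSpace k) N _ ⟩
        N * (∑[ c ∈ vectorSpace k ] ∑[ x ∈ vectorSpace n ] 𝟙 (dot (combination c) x ≟ 0#))
          ≡⟨ ≡.cong (N *_) (∑-swap (vectorSpace k) (vectorSpace n) _) ⟩
        N * (∑[ x ∈ vectorSpace n ] ∑[ c ∈ vectorSpace k ] 𝟙 (dot (combination c) x ≟ 0#))
          ≡⟨ ≡.cong (N *_) (∑-cong (vectorSpace n) (λ x → ∑-cong (vectorSpace k) (λ c → ≟-cong
               (trans (sym (dot-swap c r x)) (dot-comm c (values x)))))) ⟩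
        N * (∑[ x ∈ vectorSpace n ] ∑[ c ∈ vectorSpace k ] 𝟙 (dot (values x) c ≟ 0#))
          ≡⟨ ∑-*ˡ (vectorSpace n) N _ ⟨
        (∑[ x ∈ vectorSpace n ] N * (∑[ c ∈ vectorSpace k ] 𝟙 (dot (values x) c ≟ 0#)))
          ≡⟨ ∑-cong (vectorSpace n) (λ x → annihilator-count (values x)) ⟩
        (∑[ x ∈ vectorSpace n ] N ^ k * (1 + N′ * 𝟙 (values x ≟ᵥ 0ᵥ)))
          ≡⟨ weighted-count (λ x → 𝟙 (values x ≟ᵥ 0ᵥ)) (N ^ k) ⟩
        N ^ k * (N ^ n + N′ * K)     ≡⟨ expand′ (N ^ n) (N ^ k) N′ K ⟩
        N ^ n * N ^ k + K * N ^ k * N′ ∎)))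
      where
      open ≡.≡-Reasoning
      combination : V k → V n
      combination c j = dot c (λ i → r i j)
      values : V n → V k
      values x i = dot (r i) x
      K = ∑[ x ∈ vectorSpace n ] 𝟙 (values x ≟ᵥ 0ᵥ)
      expand : ∀ a b u → a * b + a * u ≡ a * (b + u * 1)
      expand = solve-∀
      expand′ : ∀ a b u t → b * (a + u * t) ≡ a * b + t * b * u
      expand′ = solve-∀

    -- A vector x killed by the k chosen independent rows is killed by every row: a row with nonzero
    -- value at x could be added to the chosen ones, contradicting maximality. Hence the kernel is
    -- the solution set of k independent equations.
    kernel-count : 1 ≤ N′ → ∀ {k n} {A : Mat F n} → HasRank F A k →
      (∑[ x ∈ vectorSpace n ] 𝟙 ((λ i → dot (A i) x) ≟ᵥ 0ᵥ)) * N ^ k ≡ N ^ n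
    kernel-count 1≤N′ {k} {n} {A} ((σ , σ-injective , independent) , maximal) = ≡.trans
      (≡.cong (_* N ^ k) (∑-cong (vectorSpace n) (λ x → 𝟙-cong
        ((λ i → dot (A i) x) ≟ᵥ 0ᵥ) ((λ i → dot (A (σ i)) x) ≟ᵥ 0ᵥ) (_∘ σ) (selected⇒all x))))
      (solution-count 1≤N′ (A ∘ σ) independent)
      where
      extended-independent : ∀ x → (∀ s → dot (A (σ s)) x ≈ 0#) → ∀ i → ¬ (dot (A i) x ≈ 0#) →
                             RankAtLeast F A (suc k)
      extended-independent x σx≈0 i ix≉0 = τ , τ-injective , τ-independent
        where
        τ : Fin (suc k) → Fin n
        τ zero    = i
        τ (suc s) = σ s
        i≢σ : ∀ s → i ≢ σ s
        i≢σ s ≡.refl = ix≉0 (σx≈0 s)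
        τ-injective : ∀ {s t} → τ s ≡ τ t → s ≡ t
        τ-injective {zero}  {zero}  _  = ≡.refl
        τ-injective {zero}  {suc t} eq = ⊥-elim (i≢σ t eq)
        τ-injective {suc s} {zero}  eq = ⊥-elim (i≢σ s (≡.sym eq))
        τ-injective {suc s} {suc t} eq = ≡.cong suc (σ-injective eq)
        τ-independent : LinIndep F (A ∘ τ)
        τ-independent coef vanishes = λ { zero → coef₀≈0 ; (suc s) → coef-σ s }
          where
          open R
          -- Evaluating the vanishing combination at x removes all chosen rows and isolates the
          -- coefficient of the new one.
          coef₀≈0 : coef zero ≈ 0#
          coef₀≈0 = no-zero-divisors ix≉0 (begin
            dot (A i) x ⊗ coef zero
              ≈⟨ trans (*-comm _ _) (sym (+-identityʳ _)) ⟩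
            coef zero ⊗ dot (A i) x ⊕ 0#
              ≈⟨ +-congˡ (trans (dot-comm (coef ∘ suc) _) (dot-0ˡ σx≈0 (coef ∘ suc))) ⟨
            dot coef (λ s → dot (A (τ s)) x)
              ≈⟨ dot-swap coef (A ∘ τ) x ⟩
            dot (λ j → dot coef (λ s → A (τ s) j)) x
              ≈⟨ dot-0ˡ (λ j → trans (sym (reflexive (sumF≡sum (λ s → coef s ⊗ A (τ s) j)))) (vanishes j)) x ⟩
            0# ∎)
          coef-σ : ∀ s → coef (suc s) ≈ 0#
          coef-σ = independent (coef ∘ suc) (λ j → trans (sym (+-identityˡ _))
            (trans (+-congʳ (sym (trans (*-congʳ coef₀≈0) (zeroˡ _)))) (vanishes j)))
      selected⇒all : ∀ x → (∀ s → dot (A (σ s)) x ≈ 0#) → ∀ i → dot (A i) x ≈ 0#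
      selected⇒all x σx≈0 i with dot (A i) x ≟ 0#
      ... | yes ix≈0 = ix≈0
      ... | no  ix≉0 = ⊥-elim (maximal (extended-independent x σx≈0 i ix≉0))

-- Conjugation and norm of the quadratic extension

prime-power≥2 : ∀ {q} → IsPrimePower q → 2 ≤ q
prime-power≥2 (p , suc e , isPrime , _ , ≡.refl) =
  ℕₚ.≤-trans 2≤p (ℕₚ.m≤m*n p (p ^ e) {{ℕₚ.m^n≢0 p e {{prime⇒nonZero isPrime}}}})
  where
  2≤p : 2 ≤ p
  2≤p = ℕ.nonTrivial⇒n>1 p {{prime⇒nonTrivial isPrime}}

module Conjugation {c ℓ} (F : CommutativeRing c ℓ) (isField : IsField F)
  {q : ℕ} (primePower : IsPrimePower q) (card : HasCardinality F (q ^ 2)) where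

  open Vectors F isField card public
  private
    module R = SetoidReasoning setoid

  private
    u : ℕ
    u = q ∸ 2
    q≡ : q ≡ suc (suc u)
    q≡ = ≡.sym (ℕₚ.m+[n∸m]≡n (prime-power≥2 primePower))

  q<q² : q < q ^ 2
  q<q² = ≡.subst (q <_) (≡.cong (q *_) (≡.sym (ℕₚ.*-identityʳ q)))
    (ℕₚ.m<m*n q q {{ℕ.>-nonZero (ℕₚ.<-trans (s≤s z≤n) (prime-power≥2 primePower))}} (prime-power≥2 primePower))

  conj : Carrier → Carrier
  conj x = x ↑ q

  conj-cong : ∀ {x y} → x ≈ y → conj x ≈ conj y
  conj-cong = ↑-congˡ q

  conj-⊗ : ∀ x y → conj (x ⊗ y) ≈ conj x ⊗ conj y
  conj-⊗ x y = ↑-distrib-⊗ x y q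

  -- The cardinality supplies the characteristic: q² · 1 = 0 with q² = p^(2e) forces p · 1 = 0, and
  -- x ↦ x^q is the e-th iterate of the Frobenius map.
  conj-⊕ : ∀ x y → conj (x ⊕ y) ≈ conj x ⊕ conj y
  conj-⊕ = additive primePower N·1≈0
    where
    additive : ∀ {q} → IsPrimePower q → (q ^ 2) · 1# ≈ 0# → ∀ x y → (x ⊕ y) ↑ q ≈ x ↑ q ⊕ y ↑ q
    additive (p , e , isPrime , _ , ≡.refl) q²≈0 = freshman-power isPrime
      (prime-characteristic p (e * 2) (trans (reflexive (≡.cong (_· 1#) (≡.sym (ℕₚ.^-*-assoc p e 2)))) q²≈0)) e

  conj-involutive : ∀ x → conj (conj x) ≈ x
  conj-involutive x = trans (↑-assocʳ x q q)
    (trans (↑-congʳ x (≡.cong (q *_) (≡.sym (ℕₚ.*-identityʳ q)))) (x↑N≈x x))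

  conj-0 : conj 0# ≈ 0#
  conj-0 = x⊕y≈y⇒x≈0 (trans (sym (conj-⊕ 0# 0#)) (conj-cong (+-identityˡ 0#)))

  conj-1 : conj 1# ≈ 1#
  conj-1 = begin
    conj 1#                       ≈⟨ trans (sym (*-identityʳ _)) (*-congˡ (sym (conj-involutive 1#))) ⟩
    conj 1# ⊗ conj (conj 1#)      ≈⟨ conj-⊗ 1# (conj 1#) ⟨
    conj (1# ⊗ conj 1#)           ≈⟨ conj-cong (*-identityˡ _) ⟩
    conj (conj 1#)                ≈⟨ conj-involutive 1# ⟩
    1#                            ∎
    where open R

  conj-- : ∀ x → conj (- x) ≈ - conj x
  conj-- x = +-inverseˡ-unique _ _
    (trans (sym (conj-⊕ (- x) x)) (trans (conj-cong (-‿inverseˡ x)) conj-0))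

  conj≈0 : ∀ {x} → conj x ≈ 0# → x ≈ 0#
  conj≈0 = ↑-zero q

  -- Since q ≥ 2, the polynomial x^q + b x is monic of degree q with coefficients 0, b, 0, ..., 0.
  -- The case b = 1 bounds the elements of trace zero, b = -1 the fixed elements.
  linear-perturbation-roots : ∀ b → (∑[ x ∈ finiteField ] 𝟙 (conj x ⊕ b ⊗ x ≟ 0#)) ≤ q
  linear-perturbation-roots b = ≡.subst (_≤ q)
    (∑-cong finiteField (λ x → ≟-cong (evaluate x)))
    (root-count q cs (≡.trans (≡.cong (2 +_) (Listₚ.length-replicate u)) (≡.sym q≡)))
    where
    cs = 0# ∷ b ∷ replicate u 0#
    evaluate : ∀ x → evalMonic cs x ≈ conj x ⊕ b ⊗ x
    evaluate x = begin
      0# ⊕ x ⊗ (b ⊕ x ⊗ evalMonic (replicate u 0#) x)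
        ≈⟨ trans (+-identityˡ _) (*-congˡ (+-congˡ (*-congˡ (evalMonic-replicate u x)))) ⟩
      x ⊗ (b ⊕ x ⊗ x ↑ u)
        ≈⟨ solve 3 (λ x b y → x :* (b :+ x :* y) := x :* (x :* y) :+ b :* x) refl x b (x ↑ u) ⟩
      x ↑ suc (suc u) ⊕ b ⊗ x
        ≈⟨ +-congʳ (↑-congʳ x (≡.sym q≡)) ⟩
      conj x ⊕ b ⊗ x ∎
      where open R

  -- Otherwise x^q + x would have q² > q roots. Such an s replaces division by 2 in the polarization
  -- argument, which then holds in every characteristic.
  exists-trace≉0 : ∃ λ s → ¬ (s ⊕ conj s ≈ 0#)
  exists-trace≉0 with FiniteSetoid.any? finiteField
    (λ x≈y nx ny → nx (trans (+-cong x≈y (conj-cong x≈y)) ny))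
    (λ s → ¬? (s ⊕ conj s ≟ 0#))
  ... | yes found = found
  ... | no  none  = ⊥-elim (ℕₚ.<⇒≱ q<q² (begin
    q ^ 2                                                     ≡⟨ ℕₚ.*-identityʳ _ ⟨
    q ^ 2 * 1                                                 ≡⟨ ∑-const finiteField 1 ⟨
    (∑[ x ∈ finiteField ] 1)
      ≡⟨ ∑-cong finiteField (λ x → 𝟙-yes (conj x ⊕ 1# ⊗ x ≟ 0#) (all-zero x)) ⟨
    (∑[ x ∈ finiteField ] 𝟙 (conj x ⊕ 1# ⊗ x ≟ 0#))           ≤⟨ linear-perturbation-roots 1# ⟩
    q                                                         ∎))
    where
    open ℕₚ.≤-Reasoning
    all-zero : ∀ x → conj x ⊕ 1# ⊗ x ≈ 0#
    all-zero x with x ⊕ conj x ≟ 0#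
    ... | yes eq = trans (+-congˡ (*-identityˡ x)) (trans (+-comm _ _) eq)
    ... | no neq = ⊥-elim (none (x , neq))

  -- The subfield F_q, described inside the large field.
  Fixed : Carrier → Set ℓ
  Fixed x = conj x ≈ x

  Fixed? : ∀ x → Dec (Fixed x)
  Fixed? x = conj x ≟ x

  fixed-count : (∑[ x ∈ finiteField ] 𝟙 (Fixed? x)) ≤ q
  fixed-count = ≡.subst (_≤ q) (∑-cong finiteField (λ x → 𝟙-cong
      (conj x ⊕ (- 1#) ⊗ x ≟ 0#) (conj x ≟ x)
      (λ eq → x∙y⁻¹≈ε⇒x≈y _ _ (trans (minus x) eq))
      (λ eq → trans (sym (minus x)) (trans (+-congʳ eq) (-‿inverseʳ x)))))
    (linear-perturbation-roots (- 1#))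
    where
    minus : ∀ x → conj x - x ≈ conj x ⊕ (- 1#) ⊗ x
    minus x = +-congˡ (trans (-‿cong (sym (*-identityˡ x))) (-‿distribˡ-* 1# x))

  fixed-- : ∀ {x} → Fixed x → Fixed (- x)
  fixed-- {x} eq = trans (conj-- x) (-‿cong eq)

  fixed-⊗ : ∀ {x y} → Fixed x → Fixed y → Fixed (x ⊗ y)
  fixed-⊗ {x} {y} ex ey = trans (conj-⊗ x y) (*-cong ex ey)

  norm : Carrier → Carrier
  norm a = conj a ⊗ a

  norm-fixed : ∀ a → Fixed (norm a)
  norm-fixed a = trans (conj-⊗ _ _) (trans (*-congʳ (conj-involutive a)) (*-comm _ _))

  norm≈0 : ∀ {a} → norm a ≈ 0# → a ≈ 0#
  norm≈0 {a} eq with a ≟ 0#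
  ... | yes a≈0 = a≈0
  ... | no a≉0 = no-zero-divisors (a≉0 ∘ conj≈0) eq

  norm-0 : ∀ {a} → a ≈ 0# → norm a ≈ 0#
  norm-0 a≈0 = trans (*-congˡ a≈0) (zeroʳ _)

  -- The elements of the fibre are roots of the monic polynomial x^(q+1) - b.
  norm-fiber≤ : ∀ b → (∑[ a ∈ finiteField ] 𝟙 (norm a ≟ b)) ≤ suc q
  norm-fiber≤ b = ≡.subst (_≤ suc q)
    (∑-cong finiteField (λ a → 𝟙-cong (evalMonic cs a ≟ 0#) (norm a ≟ b)
      (λ eq → x∙y⁻¹≈ε⇒x≈y _ _ (trans (sym (evaluate a)) eq))
      (λ eq → trans (evaluate a) (trans (+-congʳ eq) (-‿inverseʳ b)))))
    (root-count (suc q) cs (≡.cong suc (Listₚ.length-replicate q)))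
    where
    cs = - b ∷ replicate q 0#
    evaluate : ∀ a → evalMonic cs a ≈ norm a - b
    evaluate a = trans (+-congˡ (trans (*-congˡ (evalMonic-replicate q a)) (*-comm _ _))) (+-comm _ _)

  -- The fibres over the at most q − 1 nonzero fixed elements have at most q + 1 elements each,
  -- and together they contain all q² − 1 = (q − 1)(q + 1) nonzero elements.
  norm-fiber : ∀ {b} → ¬ (b ≈ 0#) → Fixed b → (∑[ a ∈ finiteField ] 𝟙 (norm a ≟ b)) ≡ suc q
  -- The weight β restricts the comparison to nonzero fixed values; since β b = 1, equality of the
  -- weighted terms at b gives the size of the fibre.
  norm-fiber {b} b≉0 b-fixed = ≡.trans (≡.sym (ℕₚ.*-identityˡ _))
    (≡.trans (≡.cong (_* fiber b) (≡.sym βb≡1)) (≡.trans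
      (∑-equality finiteField
        (λ x≈y → ≡.cong₂ _*_ (β-cong x≈y) (fiber-cong x≈y))
        (λ x≈y → ≡.cong (_* suc q) (β-cong x≈y))
        (λ x → ℕₚ.*-monoʳ-≤ (β x) (norm-fiber≤ x)) total b)
      (≡.trans (≡.cong (_* suc q) βb≡1) (ℕₚ.*-identityˡ (suc q)))))
    where
    open ℕₚ.≤-Reasoning
    Value? : ∀ x → Dec ((¬ x ≈ 0#) × Fixed x)
    Value? x = ¬? (x ≟ 0#) ×-dec Fixed? x
    β fiber : Carrier → ℕ
    β x = 𝟙 (Value? x)
    fiber x = ∑[ a ∈ finiteField ] 𝟙 (norm a ≟ x)
    βb≡1 : β b ≡ 1
    βb≡1 = 𝟙-yes (Value? b) (b≉0 , b-fixed)
    β-cong : ∀ {x y} → x ≈ y → β x ≡ β y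
    β-cong {x} {y} x≈y = 𝟙-cong (Value? x) (Value? y) (transport x≈y) (transport (sym x≈y))
      where
      transport : ∀ {x y} → x ≈ y → (¬ x ≈ 0#) × Fixed x → (¬ y ≈ 0#) × Fixed y
      transport x≈y (nz , fx) = nz ∘ trans x≈y , trans (conj-cong (sym x≈y)) (trans fx x≈y)
    fiber-cong : ∀ {x y} → x ≈ y → fiber x ≡ fiber y
    fiber-cong {x} {y} x≈y = ∑-cong finiteField (λ a → 𝟙-cong (norm a ≟ x) (norm a ≟ y)
      (λ eq → trans eq x≈y) (λ eq → trans eq (sym x≈y)))
    -- The element 0 completes the nonzero fixed elements to all fixed elements, whence the
    -- successor.
    values≤ : suc (∑ finiteField β) ≤ q
    values≤ = begin
      1 + ∑ finiteField β
        ≡⟨ ≡.cong (_+ ∑ finiteField β) (∑-indicator finiteField 0#) ⟨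
      (∑[ x ∈ finiteField ] 𝟙 (x ≟ 0#)) + ∑ finiteField β
        ≡⟨ ∑-+ finiteField (λ x → 𝟙 (x ≟ 0#)) β ⟨
      (∑[ x ∈ finiteField ] 𝟙 (x ≟ 0#) + β x)
        ≡⟨ ∑-cong finiteField split ⟩
      (∑[ x ∈ finiteField ] 𝟙 (Fixed? x))
        ≤⟨ fixed-count ⟩
      q ∎
      where
      split : ∀ x → 𝟙 (x ≟ 0#) + β x ≡ 𝟙 (Fixed? x)
      split x with x ≟ 0# | Fixed? x
      ... | yes _   | yes _ = ≡.refl
      ... | yes x≈0 | no nf = ⊥-elim (nf (trans (conj-cong x≈0) (trans conj-0 (sym x≈0))))
      ... | no _    | yes _ = ≡.refl
      ... | no _    | no _  = ≡.refl
    -- A nonzero a lies in exactly one of these fibres, the one over its norm; the successor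
    -- accounts for a = 0.
    fibers-total : suc (∑[ x ∈ finiteField ] β x * fiber x) ≡ q ^ 2
    fibers-total = begin-equality
      1 + (∑[ x ∈ finiteField ] β x * fiber x)
        ≡⟨ ≡.cong suc (∑-cong finiteField (λ x → ≡.trans (≡.sym (∑-*ˡ finiteField (β x) _))
             (∑-cong finiteField (λ a → ≡.trans (ℕₚ.*-comm (β x) _)
               (≡.cong (_* β x) (𝟙-cong (norm a ≟ x) (x ≟ norm a) sym sym)))))) ⟩
      1 + (∑[ x ∈ finiteField ] ∑[ a ∈ finiteField ] 𝟙 (x ≟ norm a) * β x)
        ≡⟨ ≡.cong suc (∑-swap finiteField finiteField _) ⟩
      1 + (∑[ a ∈ finiteField ] ∑[ x ∈ finiteField ] 𝟙 (x ≟ norm a) * β x)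
        ≡⟨ ≡.cong suc (∑-cong finiteField (λ a → ∑-select finiteField (norm a) β β-cong)) ⟩
      1 + (∑[ a ∈ finiteField ] β (norm a))
        ≡⟨ ≡.cong (_+ (∑[ a ∈ finiteField ] β (norm a))) (∑-indicator finiteField 0#) ⟨
      (∑[ a ∈ finiteField ] 𝟙 (a ≟ 0#)) + (∑[ a ∈ finiteField ] β (norm a))
        ≡⟨ ∑-+ finiteField _ _ ⟨
      (∑[ a ∈ finiteField ] 𝟙 (a ≟ 0#) + β (norm a))
        ≡⟨ ∑-cong finiteField (λ a → split a (a ≟ 0#)) ⟩
      (∑[ a ∈ finiteField ] 1)
        ≡⟨ ≡.trans (∑-const finiteField 1) (ℕₚ.*-identityʳ _) ⟩
      q ^ 2 ∎
      where
      split : ∀ a (d : Dec (a ≈ 0#)) → 𝟙 d + β (norm a) ≡ 1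
      split a (yes a≈0) = ≡.cong suc (𝟙-no (Value? (norm a)) (λ v → proj₁ v (norm-0 a≈0)))
      split a (no a≉0) = 𝟙-yes (Value? (norm a)) (a≉0 ∘ norm≈0 , norm-fixed a)
    -- With B values, B + 1 ≤ q is used twice: 1 + (q + 1)B = qB + (B + 1) ≤ q(B + 1) ≤ q².
    total : (∑[ x ∈ finiteField ] β x * suc q) ≤ (∑[ x ∈ finiteField ] β x * fiber x)
    total = ℕₚ.≤-pred (begin
      suc (∑[ x ∈ finiteField ] β x * suc q)
        ≡⟨ ≡.cong suc (≡.trans (∑-cong finiteField (λ x → ℕₚ.*-comm (β x) (suc q))) (∑-*ˡ finiteField (suc q) β)) ⟩
      suc (suc q * ∑ finiteField β)
        ≡⟨ expand q (∑ finiteField β) ⟩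
      q * ∑ finiteField β + suc (∑ finiteField β)
        ≤⟨ ℕₚ.+-monoʳ-≤ (q * ∑ finiteField β) values≤ ⟩
      q * ∑ finiteField β + q
        ≡⟨ contract q (∑ finiteField β) ⟩
      q * suc (∑ finiteField β)
        ≤⟨ ℕₚ.*-monoʳ-≤ q values≤ ⟩
      q * q
        ≡⟨ ≡.cong (q *_) (ℕₚ.*-identityʳ q) ⟨
      q ^ 2 ≡⟨ fibers-total ⟨
      suc (∑[ x ∈ finiteField ] β x * fiber x) ∎)
      where
      expand : ∀ q b → suc (suc q * b) ≡ q * b + suc b
      expand = solve-∀
      contract : ∀ q b → q * b + q ≡ q * suc b
      contract = solve-∀

  -- For b = 0 only a = 0 solves the equation, and the extra q makes up the difference; for b ≠ 0
  -- the solutions form the norm fibre over -b/d. The uniform right side is what produces the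
  -- recurrence for isotropic vectors.
  norm-equation-count : ∀ {d b} → ¬ (d ≈ 0#) → Fixed d → Fixed b →
    (∑[ a ∈ finiteField ] 𝟙 (norm a ⊗ d ⊕ b ≟ 0#)) + q * 𝟙 (b ≟ 0#) ≡ suc q
  norm-equation-count {d} {b} d≉0 d-fixed b-fixed with b ≟ 0# | inverse d d≉0
  ... | yes b≈0 | _ = ≡.cong₂ _+_
    (∑-unique finiteField (λ a → norm a ⊗ d ⊕ b ≟ 0#) 0#
      (λ a eq → norm≈0 (no-zero-divisors d≉0 (trans (*-comm d _)
          (trans (sym (trans (+-congˡ b≈0) (+-identityʳ _))) eq))))
      (λ a a≈0 → trans (+-cong (trans (*-congʳ (norm-0 a≈0)) (zeroˡ d)) b≈0) (+-identityˡ 0#)))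
    (ℕₚ.*-identityʳ q)
  ... | no b≉0 | e , de≈1 = ≡.trans (≡.cong ((∑[ a ∈ finiteField ] 𝟙 (norm a ⊗ d ⊕ b ≟ 0#)) +_) (ℕₚ.*-zeroʳ q))
      (≡.trans (ℕₚ.+-identityʳ _)
    (≡.trans (∑-cong finiteField (λ a → 𝟙-cong (norm a ⊗ d ⊕ b ≟ 0#) (norm a ≟ - b ⊗ e) (to a) (from a)))
      (norm-fiber (⊗-≉0 (λ eq → b≉0 (trans (sym (-‿involutive b)) (trans (-‿cong eq) -0#≈0#))) e≉0)
        (fixed-⊗ (fixed-- b-fixed) e-fixed))))
    where
    open R
    e≉0 : ¬ (e ≈ 0#)
    e≉0 e≈0 = 1≉0 (trans (sym de≈1) (trans (*-congˡ e≈0) (zeroʳ d)))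
    e-fixed : Fixed e
    e-fixed = begin
      conj e                        ≈⟨ *-identityʳ _ ⟨
      conj e ⊗ 1#                   ≈⟨ *-congˡ de≈1 ⟨
      conj e ⊗ (d ⊗ e)              ≈⟨ *-assoc _ _ _ ⟨
      (conj e ⊗ d) ⊗ e              ≈⟨ *-congʳ (trans (*-comm _ _) (*-congʳ (sym d-fixed))) ⟩
      (conj d ⊗ conj e) ⊗ e         ≈⟨ *-congʳ (trans (sym (conj-⊗ d e)) (trans (conj-cong de≈1) conj-1)) ⟩
      1# ⊗ e                        ≈⟨ *-identityˡ e ⟩
      e                             ∎
    to : ∀ a → norm a ⊗ d ⊕ b ≈ 0# → norm a ≈ - b ⊗ e
    to a eq = begin
      norm a                          ≈⟨ *-identityʳ _ ⟨
      norm a ⊗ 1#                     ≈⟨ *-congˡ de≈1 ⟨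
      norm a ⊗ (d ⊗ e)
        ≈⟨ solve 4 (λ n d b e → n :* (d :* e) := (n :* d :+ b) :* e :+ (:- b) :* e) refl (norm a) d b e ⟩
      (norm a ⊗ d ⊕ b) ⊗ e ⊕ - b ⊗ e  ≈⟨ +-congʳ (trans (*-congʳ eq) (zeroˡ e)) ⟩
      0# ⊕ - b ⊗ e                    ≈⟨ +-identityˡ _ ⟩
      - b ⊗ e                         ∎
    from : ∀ a → norm a ≈ - b ⊗ e → norm a ⊗ d ⊕ b ≈ 0#
    from a eq = begin
      norm a ⊗ d ⊕ b        ≈⟨ +-congʳ (*-congʳ eq) ⟩
      (- b ⊗ e) ⊗ d ⊕ b     ≈⟨ solve 3 (λ d b e → (:- b :* e) :* d :+ b := b :- b :* (d :* e)) refl d b e ⟩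
      b - b ⊗ (d ⊗ e)       ≈⟨ +-congˡ (-‿cong (trans (*-congˡ de≈1) (*-identityʳ b))) ⟩
      b - b                 ≈⟨ -‿inverseʳ b ⟩
      0#                    ∎

-- Isotropic vectors of hermitian forms

-- Alternating r a b d says a = b + (−1)ʳ d without subtraction.
Alternating : ℕ → ℕ → ℕ → ℕ → Set
Alternating zero          a b d = a ≡ b + d
Alternating (suc zero)    a b d = a + d ≡ b
Alternating (suc (suc r)) a b d = Alternating r a b d

-- With w = |W ∩ v^⊥| and |W| = q²w, the hypothesis q z′ = w + (-1)^r d turns q z = q(q + 1)w - q(q
-- z′) into q z = q²w + (-1)^(r+1) q d.
alternating-step : ∀ q {z z′ w} r {d} → z + q * z′ ≡ suc q * w →
  Alternating r (q * z′) w d → Alternating (suc r) (q * z) (q ^ 2 * w) (q * d)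
alternating-step q {z} {z′} {w} zero {d} eq alt = ℕₚ.+-cancelʳ-≡ (q * w) _ _ (begin
  q * z + q * d + q * w     ≡⟨ regroup q z w d ⟩
  q * (z + (w + d))         ≡⟨ ≡.cong (λ t → q * (z + t)) alt ⟨
  q * (z + q * z′)          ≡⟨ ≡.cong (q *_) eq ⟩
  q * (suc q * w)           ≡⟨ expand q w ⟩
  q ^ 2 * w + q * w         ∎)
  where
  open ≡.≡-Reasoning
  regroup : ∀ q z w d → q * z + q * d + q * w ≡ q * (z + (w + d))
  regroup = solve-∀
  expand : ∀ q w → q * (suc q * w) ≡ q * (q * 1) * w + q * w
  expand = solve-∀
alternating-step q {z} {z′} {w} (suc zero) {d} eq alt = ℕₚ.+-cancelʳ-≡ (q * (q * z′)) _ _ (begin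
  q * z + q * (q * z′)      ≡⟨ ℕₚ.*-distribˡ-+ q z (q * z′) ⟨
  q * (z + q * z′)          ≡⟨ ≡.cong (q *_) eq ⟩
  q * (suc q * w)           ≡⟨ expand q w ⟩
  q ^ 2 * w + q * w         ≡⟨ ≡.cong (λ t → q ^ 2 * w + q * t) alt ⟨
  q ^ 2 * w + q * (q * z′ + d) ≡⟨ regroup q (q ^ 2 * w) (q * z′) d ⟩
  q ^ 2 * w + q * d + q * (q * z′) ∎)
  where
  open ≡.≡-Reasoning
  regroup : ∀ q a b d → a + q * (b + d) ≡ a + q * d + q * b
  regroup = solve-∀
  expand : ∀ q w → q * (suc q * w) ≡ q * (q * 1) * w + q * w
  expand = solve-∀
alternating-step q {z} {z′} (suc (suc r)) eq alt = alternating-step q {z} {z′} r eq alt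

alternating-odd : ∀ t {a b d} → Alternating (suc (2 * t)) a b d → a + d ≡ b
alternating-odd zero    alt = alt
alternating-odd (suc t) {a} {b} {d} alt = alternating-odd t
  (≡.subst (λ s → Alternating s a b d) (ℕₚ.+-suc t (t + 0)) alt)

module HermitianForms {c ℓ} (F : CommutativeRing c ℓ) (isField : IsField F)
  {q : ℕ} (primePower : IsPrimePower q) (card : HasCardinality F (q ^ 2)) where

  open Conjugation F isField primePower card public
  private
    module R = SetoidReasoning setoid

  N : ℕ
  N = q ^ 2

  1<N : 1 < N
  1<N = ℕₚ.≤-trans (prime-power≥2 primePower) (ℕₚ.<⇒≤ q<q²)

  module Form {n : ℕ} (h : V n → V n → Carrier)
    (h-cong : ∀ {x x′ y y′} → x ≋ x′ → y ≋ y′ → h x y ≈ h x′ y′)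
    (h-⊞ : ∀ x y z → h x (y ⊞ z) ≈ h x y ⊕ h x z)
    (h-⊡ : ∀ a x y → h x (a ⊡ y) ≈ a ⊗ h x y)
    (h-conj : ∀ x y → h y x ≈ conj (h x y))
    (Radical : V n → Set ℓ) (Radical? : ∀ x → Dec (Radical x))
    (radical-⊥ : ∀ {x} → Radical x → ∀ y → h y x ≈ 0#) where

    private
      Vₙ = vectorSpace n

    f : V n → Carrier
    f x = h x x

    f-cong : ∀ {x y} → x ≋ y → f x ≈ f y
    f-cong eq = h-cong eq eq

    f-fixed : ∀ x → Fixed (f x)
    f-fixed x = sym (h-conj x x)

    h-⊥-sym : ∀ {x y} → h x y ≈ 0# → h y x ≈ 0#
    h-⊥-sym {x} {y} eq = trans (h-conj x y) (trans (conj-cong eq) conj-0)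

    h-line : ∀ x y a v → h x (y ⊞ a ⊡ v) ≈ h x y ⊕ a ⊗ h x v
    h-line x y a v = trans (h-⊞ x y (a ⊡ v)) (+-congˡ (h-⊡ a x v))

    h-lineˡ : ∀ y a v x → h (y ⊞ a ⊡ v) x ≈ h y x ⊕ conj a ⊗ h v x
    h-lineˡ y a v x = begin
      h (y ⊞ a ⊡ v) x                     ≈⟨ h-conj x (y ⊞ a ⊡ v) ⟩
      conj (h x (y ⊞ a ⊡ v))              ≈⟨ conj-cong (h-line x y a v) ⟩
      conj (h x y ⊕ a ⊗ h x v)            ≈⟨ trans (conj-⊕ _ _) (+-congˡ (conj-⊗ _ _)) ⟩
      conj (h x y) ⊕ conj a ⊗ conj (h x v) ≈⟨ +-cong (h-conj x y) (*-congˡ (h-conj x v)) ⟨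
      h y x ⊕ conj a ⊗ h v x              ∎
      where open R

    f-line : ∀ y a v → f (y ⊞ a ⊡ v) ≈
             (f y ⊕ (a ⊗ h y v ⊕ conj (a ⊗ h y v))) ⊕ norm a ⊗ f v
    f-line y a v = begin
      h (y ⊞ a ⊡ v) (y ⊞ a ⊡ v)
        ≈⟨ h-line _ y a v ⟩
      h (y ⊞ a ⊡ v) y ⊕ a ⊗ h (y ⊞ a ⊡ v) v
        ≈⟨ +-cong (h-lineˡ y a v y) (*-congˡ (h-lineˡ y a v v)) ⟩
      (f y ⊕ conj a ⊗ h v y) ⊕ a ⊗ (h y v ⊕ conj a ⊗ f v)
        ≈⟨ solve 6 (λ fy ca hvy a hyv fv → (fy :+ ca :* hvy) :+ a :* (hyv :+ ca :* fv) :=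
             (fy :+ (a :* hyv :+ ca :* hvy)) :+ (ca :* a) :* fv) refl (f y) (conj a) (h v y) a (h y v) (f v) ⟩
      (f y ⊕ (a ⊗ h y v ⊕ conj a ⊗ h v y)) ⊕ norm a ⊗ f v
        ≈⟨ +-congʳ (+-congˡ (+-congˡ (trans (*-congˡ (h-conj y v)) (sym (conj-⊗ _ _))))) ⟩
      (f y ⊕ (a ⊗ h y v ⊕ conj (a ⊗ h y v))) ⊕ norm a ⊗ f v ∎
      where open R

    -- The last two fields say that the radical of the form restricted to W is again `Radical`. All
    -- subspaces in the splitting thus share one radical, and a totally isotropic one must equal it.
    record Subspace : Set (c ⊔ Level.suc ℓ) where
      field
        W   : V n → Set ℓ
        W?  : ∀ x → Dec (W x)
        resp : ∀ {x y} → x ≋ y → W x → W y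
        0∈W : W 0ᵥ
        line : ∀ {x v} a → W x → W v → W (x ⊞ a ⊡ v)
        radical⊆ : ∀ {x} → Radical x → W x
        ⊥⊆radical : ∀ {x} → W x → (∀ y → W y → h y x ≈ 0#) → Radical x

      cardinality : ℕ
      cardinality = ∑[ x ∈ Vₙ ] 𝟙 (W? x)

      isotropic : ℕ
      isotropic = ∑[ x ∈ Vₙ ] 𝟙 (W? x) * 𝟙 (f x ≟ 0#)

      cardinality≥1 : 1 ≤ cardinality
      cardinality≥1 = ≡.subst (_≤ cardinality) (∑-indicator Vₙ 0ᵥ) (∑-mono Vₙ pointwise)
        where
        pointwise : ∀ x → 𝟙 (x ≟ᵥ 0ᵥ) ≤ 𝟙 (W? x)
        pointwise x with x ≟ᵥ 0ᵥ
        ... | no _ = z≤n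
        ... | yes x≋0 = ℕₚ.≤-reflexive (≡.sym (𝟙-yes (W? x) (resp (λ i → sym (x≋0 i)) 0∈W)))

    radicalSize : ℕ
    radicalSize = ∑[ x ∈ Vₙ ] 𝟙 (Radical? x)

    module _ (S : Subspace) where
      open Subspace S

      -- If h y x were nonzero, some a would make a · h y x an element s of nonzero trace, and then
      -- f(y + a x) = s + conj s would be nonzero.
      polarization : (∀ x → W x → f x ≈ 0#) → ∀ x y → W x → W y → h y x ≈ 0#
      polarization f≡0 x y x∈W y∈W with h y x ≟ 0#
      ... | yes eq = eq
      ... | no hyx≉0 with exists-trace≉0 | inverse (h y x) hyx≉0
      ... | s , s≉0 | b , hb≈1 = ⊥-elim (s≉0 (begin
        s ⊕ conj s
          ≈⟨ +-cong (sym ah≈s) (conj-cong (sym ah≈s)) ⟩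
        a ⊗ h y x ⊕ conj (a ⊗ h y x)
          ≈⟨ trans (+-identityʳ _) (+-identityˡ _) ⟨
        (0# ⊕ (a ⊗ h y x ⊕ conj (a ⊗ h y x))) ⊕ 0#
          ≈⟨ +-cong (+-congʳ (f≡0 y y∈W)) (trans (*-congˡ (f≡0 x x∈W)) (zeroʳ _)) ⟨
        (f y ⊕ (a ⊗ h y x ⊕ conj (a ⊗ h y x))) ⊕ norm a ⊗ f x
          ≈⟨ f-line y a x ⟨
        f (y ⊞ a ⊡ x)
          ≈⟨ f≡0 _ (line a y∈W x∈W) ⟩
        0# ∎))
        where
        open R
        a = s ⊗ b
        ah≈s : a ⊗ h y x ≈ s
        ah≈s = trans (*-assoc s b _) (trans (*-congˡ (trans (*-comm b _) hb≈1)) (*-identityʳ s))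

      module _ (v : V n) (v∈W : W v) (fv≉0 : ¬ (f v ≈ 0#)) where

        complement : Subspace
        complement = record
          { W = λ x → W x × h v x ≈ 0#
          ; W? = λ x → W? x ×-dec (h v x ≟ 0#)
          ; resp = λ x≋y (x∈W , ⊥) → resp x≋y x∈W , trans (h-cong (λ _ → refl) (λ i → sym (x≋y i))) ⊥
          ; 0∈W = 0∈W , trans (h-cong (λ _ → refl) (λ _ → sym (zeroˡ 0#))) (trans (h-⊡ 0# v 0ᵥ) (zeroˡ _))
          ; line = λ {x} {y} a (x∈W , x⊥) (y∈W , y⊥) → line a x∈W y∈W ,
              trans (h-line v x a y) (trans (+-cong x⊥ (trans (*-congˡ y⊥) (zeroʳ a))) (+-identityˡ 0#))
          ; radical⊆ = λ r → radical⊆ r , radical-⊥ r v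
          ; ⊥⊆radical = λ {x} (x∈W , x⊥) ⊥ → ⊥⊆radical x∈W (orthogonal x∈W x⊥ ⊥)
          }
          where
          open R
          orthogonal : ∀ {x} → W x → h v x ≈ 0# → (∀ y → W y × h v y ≈ 0# → h y x ≈ 0#) →
                       ∀ y → W y → h y x ≈ 0#
          orthogonal {x} x∈W v⊥x ⊥ y y∈W with inverse (f v) fv≉0
          ... | e , fe≈1 = begin
            h y x                        ≈⟨ trans (+-congˡ (trans (*-congˡ v⊥x) (zeroʳ _))) (+-identityʳ _) ⟨
            h y x ⊕ conj a ⊗ h v x       ≈⟨ h-lineˡ y a v x ⟨
            h (y ⊞ a ⊡ v) x              ≈⟨ ⊥ (y ⊞ a ⊡ v) (line a y∈W v∈W , v⊥y′) ⟩
            0#                           ∎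
            where
            -- The Gram-Schmidt coefficient -h(v, y)/f(v): it moves y into the complement, and the
            -- value against x does not change because x is orthogonal to v.
            a = - h v y ⊗ e
            v⊥y′ : h v (y ⊞ a ⊡ v) ≈ 0#
            v⊥y′ = begin
              h v (y ⊞ a ⊡ v)                 ≈⟨ h-line v y a v ⟩
              h v y ⊕ (- h v y ⊗ e) ⊗ f v
                ≈⟨ solve 3 (λ b e d → b :+ (:- b :* e) :* d := b :- b :* (d :* e)) refl (h v y) e (f v) ⟩
              h v y - h v y ⊗ (f v ⊗ e)       ≈⟨ +-congˡ (-‿cong (trans (*-congˡ fe≈1) (*-identityʳ _))) ⟩
              h v y - h v y                   ≈⟨ -‿inverseʳ _ ⟩
              0#                              ∎

        private
          module S′ = Subspace complement
          open S′ using () renaming (W to W′; W? to W′?)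

        shift-back : ∀ x a → (x ⊞ a ⊡ v) ⊞ (- a) ⊡ v ≋ x
        shift-back x a i = solve 3 (λ x a v → (x :+ a :* v) :+ (:- a) :* v := x) refl (x i) a (v i)

        shift-forth : ∀ x a → (x ⊞ (- a) ⊡ v) ⊞ a ⊡ v ≋ x
        shift-forth x a i = solve 3 (λ x a v → (x :+ (:- a) :* v) :+ a :* v := x) refl (x i) a (v i)

        -- As a function of a, h v (x - a v) is affine with nonzero slope -f v, so for x in W
        -- exactly one a qualifies; for x outside W none does, as W contains v.
        projection-unique : ∀ x → (∑[ a ∈ finiteField ] 𝟙 (W′? (x ⊞ (- a) ⊡ v))) ≡ 𝟙 (W? x)
        projection-unique x with W? x
        ... | no x∉W = ∑-zero finiteField (λ a → 𝟙-no (W′? (x ⊞ (- a) ⊡ v))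
          (λ (∈W , _) → x∉W (resp (shift-forth x a) (line a ∈W v∈W))))
        ... | yes x∈W = ≡.trans
          (∑-cong finiteField (λ a → 𝟙-cong (W′? (x ⊞ (- a) ⊡ v)) (h v x ⊕ a ⊗ (- f v) ≟ 0#)
            (λ (_ , ⊥) → trans (sym (slope a)) ⊥)
            (λ eq → line (- a) x∈W v∈W , trans (slope a) eq)))
          (solve-linear (λ eq → fv≉0 (trans (sym (-‿involutive (f v))) (trans (-‿cong eq) -0#≈0#))) (h v x))
          where
          slope : ∀ a → h v (x ⊞ (- a) ⊡ v) ≈ h v x ⊕ a ⊗ (- f v)
          slope a = trans (h-line v x (- a) v)
            (+-congˡ (trans (sym (-‿distribˡ-* a (f v))) (-‿distribʳ-* a (f v))))

        -- Every element of W is uniquely y + a v with y in the orthogonal complement of v.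
        decomposition : (g : V n → ℕ) → (∀ {x y} → x ≋ y → g x ≡ g y) →
          (∑[ a ∈ finiteField ] ∑[ y ∈ Vₙ ] 𝟙 (W′? y) * g (y ⊞ a ⊡ v)) ≡ (∑[ x ∈ Vₙ ] 𝟙 (W? x) * g x)
        decomposition g g-cong = begin
          (∑[ a ∈ finiteField ] ∑[ y ∈ Vₙ ] 𝟙 (W′? y) * g (y ⊞ a ⊡ v))
            ≡⟨ ∑-cong finiteField (λ a → ∑-cong Vₙ (λ y → ≡.cong (_* g (y ⊞ a ⊡ v))
                 (𝟙W′-cong (λ i → sym (shift-back y a i))))) ⟩
          (∑[ a ∈ finiteField ] ∑[ y ∈ Vₙ ] G a (y ⊞ a ⊡ v))
            ≡⟨ ∑-cong finiteField (λ a → ∑-translate (G a) (λ eq → ≡.cong₂ _*_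
                 (𝟙W′-cong (λ i → +-congʳ (eq i))) (g-cong eq)) (a ⊡ v)) ⟩
          (∑[ a ∈ finiteField ] ∑[ x ∈ Vₙ ] G a x)
            ≡⟨ ∑-swap finiteField Vₙ G ⟩
          (∑[ x ∈ Vₙ ] ∑[ a ∈ finiteField ] G a x)
            ≡⟨ ∑-cong Vₙ (λ x → ≡.trans (∑-cong finiteField (λ a → ℕₚ.*-comm _ (g x)))
                 (≡.trans (∑-*ˡ finiteField (g x) _)
                     (≡.trans (≡.cong (g x *_) (projection-unique x)) (ℕₚ.*-comm (g x) _)))) ⟩
          (∑[ x ∈ Vₙ ] 𝟙 (W? x) * g x) ∎
          where
          open ≡.≡-Reasoning
          G : Carrier → V n → ℕ
          G a x = 𝟙 (W′? (x ⊞ (- a) ⊡ v)) * g x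
          𝟙W′-cong : ∀ {x y} → x ≋ y → 𝟙 (W′? x) ≡ 𝟙 (W′? y)
          𝟙W′-cong {x} {y} eq = 𝟙-cong (W′? x) (W′? y) (S′.resp eq) (S′.resp (λ i → sym (eq i)))

        complement-cardinality : cardinality ≡ N * S′.cardinality
        complement-cardinality = begin
          (∑[ x ∈ Vₙ ] 𝟙 (W? x))           ≡⟨ ∑-cong Vₙ (λ x → ≡.sym (ℕₚ.*-identityʳ _)) ⟩
          (∑[ x ∈ Vₙ ] 𝟙 (W? x) * 1)       ≡⟨ decomposition (λ _ → 1) (λ _ → ≡.refl) ⟨
          (∑[ a ∈ finiteField ] ∑[ y ∈ Vₙ ] 𝟙 (W′? y) * 1)
            ≡⟨ ∑-const finiteField _ ⟩
          N * (∑[ y ∈ Vₙ ] 𝟙 (W′? y) * 1)  ≡⟨ ≡.cong (N *_) (∑-cong Vₙ (λ x → ℕₚ.*-identityʳ _)) ⟩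
          N * S′.cardinality               ∎
          where open ≡.≡-Reasoning

        -- For y orthogonal to v the cross terms vanish and f(y + a v) = norm a · f v + f y. The
        -- norm equation is then counted separately for each y in the complement.
        complement-isotropic : isotropic + q * S′.isotropic ≡ suc q * S′.cardinality
        complement-isotropic = begin
          isotropic + q * S′.isotropic
            ≡⟨ ≡.cong₂ _+_ (≡.sym (decomposition (λ x → 𝟙 (f x ≟ 0#)) (λ eq → ≟-cong (f-cong eq))))
                 (≡.sym (∑-*ˡ Vₙ q _)) ⟩
          (∑[ a ∈ finiteField ] ∑[ y ∈ Vₙ ] 𝟙 (W′? y) * 𝟙 (f (y ⊞ a ⊡ v) ≟ 0#))
            + (∑[ y ∈ Vₙ ] q * (𝟙 (W′? y) * 𝟙 (f y ≟ 0#)))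
            ≡⟨ ≡.cong (_+ (∑[ y ∈ Vₙ ] q * (𝟙 (W′? y) * 𝟙 (f y ≟ 0#)))) (≡.trans (∑-swap finiteField Vₙ _)
                 (∑-cong Vₙ (λ y → ∑-*ˡ finiteField (𝟙 (W′? y)) _))) ⟩
          (∑[ y ∈ Vₙ ] 𝟙 (W′? y) * (∑[ a ∈ finiteField ] 𝟙 (f (y ⊞ a ⊡ v) ≟ 0#)))
            + (∑[ y ∈ Vₙ ] q * (𝟙 (W′? y) * 𝟙 (f y ≟ 0#)))
            ≡⟨ ∑-+ Vₙ _ _ ⟨
          (∑[ y ∈ Vₙ ] 𝟙 (W′? y) * (∑[ a ∈ finiteField ] 𝟙 (f (y ⊞ a ⊡ v) ≟ 0#)) + q * (𝟙 (W′? y) * 𝟙 (f y ≟ 0#)))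
            ≡⟨ ∑-cong Vₙ (λ y → fiber y (W′? y)) ⟩
          (∑[ y ∈ Vₙ ] suc q * 𝟙 (W′? y))
            ≡⟨ ∑-*ˡ Vₙ (suc q) _ ⟩
          suc q * S′.cardinality ∎
          where
          open ≡.≡-Reasoning
          fiber : ∀ y (d : Dec (W′ y)) →
            𝟙 d * (∑[ a ∈ finiteField ] 𝟙 (f (y ⊞ a ⊡ v) ≟ 0#)) + q * (𝟙 d * 𝟙 (f y ≟ 0#)) ≡ suc q * 𝟙 d
          fiber y (no _) = ≡.trans (ℕₚ.*-zeroʳ q) (≡.sym (ℕₚ.*-zeroʳ (suc q)))
          fiber y (yes (y∈W , v⊥y)) = ≡.trans
            (≡.cong₂ (λ s t → s + q * t) (≡.trans (ℕₚ.*-identityˡ _)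
                (∑-cong finiteField (λ a → ≟-cong (orthogonal-sum a))))
              (ℕₚ.*-identityˡ _))
            (≡.trans (norm-equation-count fv≉0 (f-fixed v) (f-fixed y)) (≡.sym (ℕₚ.*-identityʳ (suc q))))
            where
            orthogonal-sum : ∀ a → f (y ⊞ a ⊡ v) ≈ norm a ⊗ f v ⊕ f y
            orthogonal-sum a = trans (f-line y a v)
                (trans (+-congʳ (trans (+-congˡ cross) (+-identityʳ _))) (+-comm _ _))
              where
              ah≈0 : a ⊗ h y v ≈ 0#
              ah≈0 = trans (*-congˡ (h-⊥-sym v⊥y)) (zeroʳ a)
              cross : a ⊗ h y v ⊕ conj (a ⊗ h y v) ≈ 0#
              cross = trans (+-cong ah≈0 (trans (conj-cong ah≈0) conj-0)) (+-identityˡ 0#)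

    -- With Z isotropic vectors in W and radical size ρ, this says qZ = |W| + (-1)^r (q - 1) ρ q^r,
    -- where r is the number of vectors split off. The induction is on a bound for |W|, since each
    -- complement is smaller by the factor N.
    isotropic-count : ∀ t → q ≡ suc t → ∀ bound (S : Subspace) → Subspace.cardinality S ≤ bound →
      ∃ λ r → Subspace.cardinality S ≡ radicalSize * N ^ r ×
        Alternating r (q * Subspace.isotropic S) (Subspace.cardinality S) (t * (radicalSize * q ^ r))
    isotropic-count t q≡ zero S ≤0 = ⊥-elim (ℕₚ.<⇒≱ (Subspace.cardinality≥1 S) ≤0)
    isotropic-count t q≡ (suc bound) S ≤bound
      with FiniteSetoid.any? Vₙ {P = λ v → Subspace.W S v × ¬ (f v ≈ 0#)}
             (λ x≋y (∈W , nz) → Subspace.resp S x≋y ∈W , nz ∘ trans (f-cong x≋y))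
             (λ v → Subspace.W? S v ×-dec ¬? (f v ≟ 0#))
    ... | yes (v , v∈W , fv≉0) = suc r , |W| ,
        ≡.subst₂ (Alternating (suc r) (q * isotropic)) (≡.sym (complement-cardinality S v v∈W fv≉0))
            (regroup q t radicalSize (q ^ r))
          (alternating-step q {isotropic} {S′.isotropic} {S′.cardinality} r
            (complement-isotropic S v v∈W fv≉0) (proj₂ (proj₂ induction)))
      where
      open Subspace S
      module S′ = Subspace (complement S v v∈W fv≉0)
      smaller : S′.cardinality < cardinality
      smaller = ≡.subst (S′.cardinality <_) (≡.trans (ℕₚ.*-comm S′.cardinality N)
          (≡.sym (complement-cardinality S v v∈W fv≉0)))
        (ℕₚ.m<m*n S′.cardinality N {{ℕ.>-nonZero S′.cardinality≥1}} 1<N)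
      induction = isotropic-count t q≡ bound (complement S v v∈W fv≉0)
        (ℕₚ.≤-pred (ℕₚ.≤-trans smaller ≤bound))
      r = proj₁ induction
      |W| : cardinality ≡ radicalSize * N ^ suc r
      |W| = ≡.trans (complement-cardinality S v v∈W fv≉0) (≡.trans (≡.cong (N *_) (proj₁ (proj₂ induction)))
        (swap N radicalSize (N ^ r)))
        where
        swap : ∀ a b c → a * (b * c) ≡ b * (a * c)
        swap = solve-∀
      regroup : ∀ q t ρ s → q * (t * (ρ * s)) ≡ t * (ρ * (q * s))
      regroup = solve-∀
    -- By polarization W is the radical, so Z = |W| = ρ and q|W| = |W| + (q - 1)ρ.
    ... | no none = 0 , |W| , (begin
        q * isotropic
          ≡⟨ ≡.cong₂ _*_ q≡ (∑-cong Vₙ (λ x → all-isotropic x (W? x))) ⟩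
        suc t * cardinality
          ≡⟨ ≡.cong (λ s → cardinality + t * s) |W| ⟩
        cardinality + t * (radicalSize * 1) ∎)
      where
      open Subspace S
      open ≡.≡-Reasoning
      f≡0 : ∀ x → W x → f x ≈ 0#
      f≡0 x x∈W with f x ≟ 0#
      ... | yes eq = eq
      ... | no neq = ⊥-elim (none (x , x∈W , neq))
      |W| : cardinality ≡ radicalSize * 1
      |W| = ≡.trans (∑-cong Vₙ (λ x → 𝟙-cong (W? x) (Radical? x)
        (λ x∈W → ⊥⊆radical x∈W (λ y y∈W → polarization S f≡0 x y x∈W y∈W)) radical⊆)) (≡.sym (ℕₚ.*-identityʳ _))
      all-isotropic : ∀ x (d : Dec (W x)) → 𝟙 d * 𝟙 (f x ≟ 0#) ≡ 𝟙 d
      all-isotropic x (no _) = ≡.refl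
      all-isotropic x (yes x∈W) = ≡.cong (1 *_) (𝟙-yes (f x ≟ 0#) (f≡0 x x∈W))

-- Constant rank-distance sets

^-injectiveʳ : ∀ {b} → 1 < b → ∀ m n → b ^ m ≡ b ^ n → m ≡ n
^-injectiveʳ {b} 1<b m n eq with ℕₚ.<-cmp m n
... | tri≈ _ m≡n _ = m≡n
... | tri< m<n _ _ = ⊥-elim (ℕₚ.<⇒≢ (ℕₚ.^-monoʳ-< b 1<b m<n) eq)
... | tri> _ _ n<m = ⊥-elim (ℕₚ.<⇒≢ (ℕₚ.^-monoʳ-< b 1<b n<m) (≡.sym eq))

∑-*-∑ : ∀ {c ℓ} (X : FiniteSetoid c ℓ) (u v : FiniteSetoid.Carrier X → ℕ) →
        ∑ X u * ∑ X v ≡ (∑[ x ∈ X ] ∑[ y ∈ X ] u x * v y)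
∑-*-∑ X u v = ≡.trans (ℕₚ.*-comm (∑ X u) (∑ X v)) (≡.trans (≡.sym (∑-*ˡ X (∑ X v) u))
  (∑-cong X (λ x → ≡.trans (ℕₚ.*-comm (∑ X v) (u x)) (≡.sym (∑-*ˡ X (u x) v)))))

finiteSet : ℕ → FiniteSetoid _ _
finiteSet m = record
  { setoid = ≡.setoid (Fin m) ; size = m ; element = λ i → i
  ; injective = λ _ _ eq → eq ; surjective = λ i → i , ≡.refl }

-- Substituting the lower bound for S into the identity and cancelling the common term and t gives
-- m(κm + mG) ≤ m(κ + 1)G. If m > κ, then (κ + 1)G ≤ mG < κm + mG, a contradiction.
counting-bound : ∀ m κ t G S → 1 ≤ κ → 1 ≤ t →
  κ * S + m * (m * (t * G)) ≡ m * (m * (κ * G)) + m * (t * (κ + 1) * G) →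
  G * (m * m) + t * (m * m) ≤ S → m ≤ κ
counting-bound m κ t@(suc _) G S 1≤κ _ total lower with m ℕₚ.≤? κ
... | yes m≤κ = m≤κ
... | no m≰κ = ⊥-elim (absurd m κ (ℕₚ.≰⇒> m≰κ) 1≤κ bound)
  where
  open ℕₚ.≤-Reasoning
  expand : ∀ m κ t G → m * (m * (κ * G)) + t * (m * (κ * m + m * G)) ≡
           κ * (G * (m * m) + t * (m * m)) + m * (m * (t * G))
  expand = solve-∀
  regroup : ∀ m κ t G → m * (m * (κ * G)) + m * (t * (κ + 1) * G) ≡
            m * (m * (κ * G)) + t * (m * ((κ + 1) * G))
  regroup = solve-∀
  bound : m * (κ * m + m * G) ≤ m * ((κ + 1) * G)
  bound = ℕₚ.*-cancelˡ-≤ t (ℕₚ.+-cancelˡ-≤ (m * (m * (κ * G))) _ _ (begin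
    m * (m * (κ * G)) + t * (m * (κ * m + m * G))
      ≡⟨ expand m κ t G ⟩
    κ * (G * (m * m) + t * (m * m)) + m * (m * (t * G))
      ≤⟨ ℕₚ.+-monoˡ-≤ _ (ℕₚ.*-monoʳ-≤ κ lower) ⟩
    κ * S + m * (m * (t * G))
      ≡⟨ total ⟩
    m * (m * (κ * G)) + m * (t * (κ + 1) * G)
      ≡⟨ regroup m κ t G ⟩
    m * (m * (κ * G)) + t * (m * ((κ + 1) * G)) ∎))
  absurd : ∀ m κ → κ < m → 1 ≤ κ → ¬ (m * (κ * m + m * G) ≤ m * ((κ + 1) * G))
  absurd m@(suc _) κ@(suc _) κ<m _ le = ℕₚ.<⇒≱ (ℕₚ.m<n+m (m * G) (ℕₚ.*-mono-≤ {1} {κ} {1} {m} (s≤s z≤n) (s≤s z≤n)))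
    (ℕₚ.≤-trans (ℕₚ.*-cancelˡ-≤ m le) (ℕₚ.*-monoˡ-≤ G (≡.subst (_≤ m) (≡.sym (ℕₚ.+-comm κ 1)) κ<m)))

-- Zeros of the form of a hermitian matrix

module HermitianMatrices {c ℓ} (F : CommutativeRing c ℓ) (isField : IsField F)
  {q : ℕ} (primePower : IsPrimePower q) (card : HasCardinality F (q ^ 2)) where

  open HermitianForms F isField primePower card public
  private
    module R = SetoidReasoning setoid

  conj-dot : ∀ {n} (x y : V n) → conj (dot x y) ≈ dot (conj ∘ x) (conj ∘ y)
  conj-dot {zero}  x y = conj-0
  conj-dot {suc n} x y = trans (conj-⊕ _ _) (+-cong (conj-⊗ _ _) (conj-dot (x ∘ suc) (y ∘ suc)))

  conj-unitVector : ∀ {n} (i : Fin n) → conj ∘ unitVector i ≋ unitVector i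
  conj-unitVector zero    zero    = conj-1
  conj-unitVector zero    (suc j) = conj-0
  conj-unitVector (suc i) zero    = conj-0
  conj-unitVector (suc i) (suc j) = conj-unitVector i j

  pow≡↑ : ∀ x m → pow F x m ≡ x ↑ m
  pow≡↑ x zero    = ≡.refl
  pow≡↑ x (suc m) = ≡.cong (x ⊗_) (pow≡↑ x m)

  apply : ∀ {n} → Mat F n → V n → V n
  apply M x i = dot (M i) x

  form : ∀ {n} → Mat F n → V n → V n → Carrier
  form M x y = dot (conj ∘ x) (apply M y)

  form-cong : ∀ {n} (M : Mat F n) {x x′ y y′} → x ≋ x′ → y ≋ y′ → form M x y ≈ form M x′ y′
  form-cong M x≋x′ y≋y′ = dot-cong (conj-cong ∘ x≋x′) (λ i → dot-cong {x = M i} (λ _ → refl) y≋y′)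

  form-conj : ∀ {n} (M : Mat F n) → IsHermitian F q M → ∀ x y → form M y x ≈ conj (form M x y)
  form-conj M hermitian x y = begin
    dot (conj ∘ y) (apply M x)
      ≈⟨ dot-swap (conj ∘ y) M x ⟩
    dot (λ j → dot (conj ∘ y) (λ i → M i j)) x
      ≈⟨ dot-comm _ x ⟩
    dot x (λ j → dot (conj ∘ y) (λ i → M i j))
      ≈⟨ dot-cong {x = x} (λ _ → refl) (λ j → trans (dot-comm (conj ∘ y) _)
           (dot-cong {y = conj ∘ y} (λ i → trans (hermitian j i) (reflexive (pow≡↑ (M j i) q))) (λ _ → refl))) ⟩
    dot x (λ j → dot (conj ∘ M j) (conj ∘ y))
      ≈⟨ dot-cong (λ i → sym (conj-involutive (x i))) (λ j → sym (conj-dot (M j) y)) ⟩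
    dot (conj ∘ conj ∘ x) (conj ∘ apply M y)
      ≈⟨ conj-dot (conj ∘ x) (apply M y) ⟨
    conj (form M x y) ∎
    where open R

  zeros : ∀ {n} → Mat F n → ℕ
  zeros {n} M = ∑[ x ∈ vectorSpace n ] 𝟙 (form M x x ≟ 0#)

  -- The count of isotropic vectors for the whole space, where oddness selects the minus sign. The
  -- kernel size ρ is eliminated through ρ q^(2k) = N^n.
  zeros-count : ∀ t → q ≡ suc t → ∀ {n k} (M : Mat F n) → IsHermitian F q M → HasRank F M k → OddNat k →
    q ^ k * (q * zeros M) + t * N ^ n ≡ q ^ k * N ^ n
  zeros-count t q≡ {n} {k} M hermitian rank (j , ≡.refl) = begin
    q ^ k * (q * zeros M) + t * N ^ n
      ≡⟨ ≡.cong (λ s → q ^ k * (q * zeros M) + t * s) (≡.trans (≡.sym kernel-size)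
           (≡.cong (ρ *_) (≡.trans (ℕₚ.^-*-assoc q 2 k)
               (≡.trans (≡.cong (λ s → q ^ (k + s)) (ℕₚ.+-identityʳ k)) (ℕₚ.^-distribˡ-+-* q k k))))) ⟩
    q ^ k * (q * zeros M) + t * (ρ * (q ^ k * q ^ k))
      ≡⟨ regroup (q ^ k) (q * zeros M) t ρ ⟩
    q ^ k * (q * zeros M + t * (ρ * q ^ k))
      ≡⟨ ≡.cong (q ^ k *_) isotropic-total ⟩
    q ^ k * N ^ n ∎
    where
    open ≡.≡-Reasoning
    regroup : ∀ κ z t ρ → κ * z + t * (ρ * (κ * κ)) ≡ κ * (z + t * (ρ * κ))
    regroup = solve-∀
    Kernel : V n → Set ℓ
    Kernel x = apply M x ≋ 0ᵥ
    form-⊞ : ∀ x y z → form M x (y ⊞ z) ≈ form M x y ⊕ form M x z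
    form-⊞ x y z = trans (dot-cong {x = conj ∘ x} (λ _ → refl) (λ i → dot-⊞ (M i) y z)) (dot-⊞ (conj ∘ x) _ _)
    form-⊡ : ∀ a x y → form M x (a ⊡ y) ≈ a ⊗ form M x y
    form-⊡ a x y = trans (dot-cong {x = conj ∘ x} (λ _ → refl) (λ i → dot-⊡ a (M i) y)) (dot-⊡ a (conj ∘ x) _)
    Kernel? : ∀ x → Dec (Kernel x)
    Kernel? x = apply M x ≟ᵥ 0ᵥ
    kernel-⊥ : ∀ {x} → Kernel x → ∀ y → form M y x ≈ 0#
    kernel-⊥ {x} x∈K y = trans (dot-comm (conj ∘ y) (apply M x)) (dot-0ˡ x∈K (conj ∘ y))
    open Form (form M) (form-cong M) form-⊞ form-⊡ (form-conj M hermitian) Kernel Kernel? kernel-⊥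
      using (Subspace; radicalSize; isotropic-count)
    ρ : ℕ
    ρ = radicalSize
    kernel-size : ρ * N ^ k ≡ N ^ n
    kernel-size = kernel-count {ℕ.pred N} (≡.sym (ℕₚ.suc-pred N {{ℕ.>-nonZero (ℕₚ.<⇒≤ 1<N)}})) (ℕₚ.pred-mono-≤ 1<N) rank
    whole : Subspace
    whole = record
      { W = λ _ → Lift ℓ ⊤ ; W? = λ _ → yes (lift tt) ; resp = λ _ w → w ; 0∈W = lift tt
      ; line = λ _ w _ → w ; radical⊆ = λ _ → lift tt
      -- Pairing with unit vectors, which conjugation fixes, reads off the coordinates of
      -- `apply M x`.
      ; ⊥⊆radical = λ {x} _ ⊥ i → trans (sym (dot-unit (apply M x) i)) (trans (dot-comm (apply M x) (unitVector i))
          (trans (dot-cong (λ s → sym (conj-unitVector i s)) (λ _ → refl)) (⊥ (unitVector i) (lift tt))))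
      }
    whole-size : Subspace.cardinality whole ≡ N ^ n
    whole-size = ≡.trans (∑-const (vectorSpace n) 1) (ℕₚ.*-identityʳ _)
    isotropic-total : q * zeros M + t * (ρ * q ^ k) ≡ N ^ n
    isotropic-total with isotropic-count t q≡ (Subspace.cardinality whole) whole ℕₚ.≤-refl
    -- Both ρ N^k and ρ N^r equal N^n, so the number of splitting steps is the rank.
    ... | r , size , alternating with ^-injectiveʳ 1<N k r (ℕₚ.*-cancelˡ-≡ (N ^ k) (N ^ r) ρ {{ρ≢0}}
            (≡.trans kernel-size (≡.trans (≡.sym whole-size) size)))
      where
      ρ≢0 : ℕ.NonZero ρ
      ρ≢0 = ℕₚ.m*n≢0⇒m≢0 ρ {{≡.subst ℕ.NonZero (≡.sym kernel-size) (ℕₚ.m^n≢0 N n {{ℕ.>-nonZero (ℕₚ.<⇒≤ 1<N)}})}}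
    ... | ≡.refl = ≡.trans
      (≡.cong (λ z → q * z + t * (ρ * q ^ k)) (∑-cong (vectorSpace n) (λ x → ≡.sym (ℕₚ.*-identityˡ _))))
      (≡.trans (alternating-odd j alternating) whole-size)

  form-difference : ∀ {n} (A B : Mat F n) x → form (_-M_ F A B) x x ⊕ form B x x ≈ form A x x
  form-difference A B x = trans (sym (dot-⊞ (conj ∘ x) _ _)) (dot-cong {x = conj ∘ x} (λ _ → refl) (λ i →
    trans (+-cong (dot-comm _ x) (dot-comm _ x)) (trans (sym (dot-⊞ x _ _)) (trans (dot-comm x _)
      (dot-cong {y = x} (λ j → solve 2 (λ a b → (a :- b) :+ b := a) refl (A i j) (B i j)) (λ _ → refl))))))

  hermitian-difference : ∀ {n} {A B : Mat F n} → IsHermitian F q A → IsHermitian F q B → IsHermitian F q (_-M_ F A B)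
  hermitian-difference {A = A} {B} hA hB i j = begin
    A j i - B j i               ≈⟨ +-cong (hA i j) (-‿cong (hB i j)) ⟩
    pow F (A i j) q - pow F (B i j) q
      ≡⟨ ≡.cong₂ _-_ (pow≡↑ (A i j) q) (pow≡↑ (B i j) q) ⟩
    conj (A i j) - conj (B i j) ≈⟨ +-congˡ (conj-- (B i j)) ⟨
    conj (A i j) ⊕ conj (- B i j) ≈⟨ conj-⊕ _ _ ⟨
    conj (A i j - B i j)        ≡⟨ pow≡↑ (A i j - B i j) q ⟨
    pow F (A i j - B i j) q     ∎
    where open R

  form-fixed : ∀ {n} {A : Mat F n} → IsHermitian F q A → ∀ x → Fixed (form A x x)
  form-fixed {A = A} hermitian x = sym (form-conj A hermitian x x)

  -- Cauchy–Schwarz over the at most q possible values.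
  collision-count : ∀ {m} (φ : Fin m → Carrier) → (∀ a → Fixed (φ a)) →
    m * m ≤ q * (∑[ a ∈ finiteSet m ] ∑[ b ∈ finiteSet m ] 𝟙 (φ a ≟ φ b))
  collision-count {m} φ φ-fixed = begin
    m * m                                   ≡⟨ ≡.cong₂ _*_ multiplicity-total multiplicity-total ⟨
    ∑ finiteField mult * ∑ finiteField mult ≤⟨ ∑-cauchy-schwarz finiteField β01 β-mult ⟩
    (∑[ x ∈ finiteField ] 𝟙 (Fixed? x)) * (∑[ x ∈ finiteField ] mult x * mult x)
                                            ≤⟨ ℕₚ.*-monoˡ-≤ _ fixed-count ⟩
    q * (∑[ x ∈ finiteField ] mult x * mult x) ≡⟨ ≡.cong (q *_) squares ⟩
    q * (∑[ a ∈ I ] ∑[ b ∈ I ] 𝟙 (φ a ≟ φ b)) ∎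
    where
    open ℕₚ.≤-Reasoning
    I = finiteSet m
    mult : Carrier → ℕ
    mult x = ∑[ a ∈ I ] 𝟙 (x ≟ φ a)
    multiplicity-total : ∑ finiteField mult ≡ m
    multiplicity-total = ≡.trans (∑-swap finiteField I _) (≡.trans
      (∑-cong I (λ a → ∑-indicator finiteField (φ a))) (≡.trans (∑-const I 1) (ℕₚ.*-identityʳ m)))
    β01 : ∀ x → 𝟙 (Fixed? x) ≡ 0 ⊎ 𝟙 (Fixed? x) ≡ 1
    β01 x with Fixed? x
    ... | yes _ = inj₂ ≡.refl
    ... | no  _ = inj₁ ≡.refl
    β-mult : ∀ x → 𝟙 (Fixed? x) * mult x ≡ mult x
    β-mult x = ≡.trans (≡.sym (∑-*ˡ I (𝟙 (Fixed? x)) _)) (∑-cong I pointwise)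
      where
      pointwise : ∀ a → 𝟙 (Fixed? x) * 𝟙 (x ≟ φ a) ≡ 𝟙 (x ≟ φ a)
      pointwise a with x ≟ φ a
      ... | no _   = ℕₚ.*-zeroʳ (𝟙 (Fixed? x))
      ... | yes eq = ≡.cong (_* 1) (𝟙-yes (Fixed? x) (trans (conj-cong eq) (trans (φ-fixed a) (sym eq))))
    -- The square of a multiplicity counts the ordered pairs of indices sharing that value.
    squares : (∑[ x ∈ finiteField ] mult x * mult x) ≡ (∑[ a ∈ I ] ∑[ b ∈ I ] 𝟙 (φ a ≟ φ b))
    squares = begin-equality
      (∑[ x ∈ finiteField ] mult x * mult x)
        ≡⟨ ∑-cong finiteField (λ x → ∑-*-∑ I (λ a → 𝟙 (x ≟ φ a)) (λ b → 𝟙 (x ≟ φ b))) ⟩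
      (∑[ x ∈ finiteField ] ∑[ a ∈ I ] ∑[ b ∈ I ] 𝟙 (x ≟ φ a) * 𝟙 (x ≟ φ b))
        ≡⟨ ∑-swap finiteField I _ ⟩
      (∑[ a ∈ I ] ∑[ x ∈ finiteField ] ∑[ b ∈ I ] 𝟙 (x ≟ φ a) * 𝟙 (x ≟ φ b))
        ≡⟨ ∑-cong I (λ a → ∑-swap finiteField I _) ⟩
      (∑[ a ∈ I ] ∑[ b ∈ I ] ∑[ x ∈ finiteField ] 𝟙 (x ≟ φ a) * 𝟙 (x ≟ φ b))
        ≡⟨ ∑-cong I (λ a → ∑-cong I (λ b → ∑-select finiteField (φ a) (λ x → 𝟙 (x ≟ φ b))
             (λ {x} {y} x≈y → 𝟙-cong (x ≟ φ b) (y ≟ φ b) (trans (sym x≈y)) (trans x≈y)))) ⟩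
      (∑[ a ∈ I ] ∑[ b ∈ I ] 𝟙 (φ a ≟ φ b)) ∎

  -- Double counting of agreements between forms

  module ConstantRankDistance {n k : ℕ} (odd : OddNat k) {m : ℕ} (U : Fin m → Mat F n)
    (hermitian : ∀ a → IsHermitian F q (U a))
    (rank : ∀ a b → a ≢ b → HasRank F (_-M_ F (U a) (U b)) k) where

    private
      I = finiteSet m
      Vₙ = vectorSpace n
      t : ℕ
      t = ℕ.pred q
      q≡ : q ≡ suc t
      q≡ = ≡.sym (ℕₚ.suc-pred q {{ℕ.>-nonZero (ℕₚ.<⇒≤ (prime-power≥2 primePower))}})

    agreements : Fin m → Fin m → ℕ
    agreements a b = ∑[ x ∈ Vₙ ] 𝟙 (form (U a) x x ≟ form (U b) x x)

    agreements-total : ℕ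
    agreements-total = ∑[ a ∈ I ] ∑[ b ∈ I ] agreements a b

    -- Off the diagonal this is the zero count for U a - U b. On the diagonal all G = N^n vectors
    -- agree, and with q = t + 1 the excess is κqG + tG - κG = t(κ + 1)G, where κ = q^k.
    agreements-count : ∀ a b → q ^ k * (q * agreements a b) + t * N ^ n ≡
                       q ^ k * N ^ n + 𝟙 (a Finₚ.≟ b) * (t * (q ^ k + 1) * N ^ n)
    agreements-count a b with a Finₚ.≟ b
    ... | yes ≡.refl = ≡.trans (≡.cong₂ (λ s z → q ^ k * (s * z) + t * N ^ n) q≡ everything)
        (expand (q ^ k) t (N ^ n))
      where
      everything : agreements a a ≡ N ^ n
      everything = ≡.trans (∑-cong Vₙ (λ x → 𝟙-yes (form (U a) x x ≟ form (U a) x x) refl))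
        (≡.trans (∑-const Vₙ 1) (ℕₚ.*-identityʳ _))
      expand : ∀ κ t G → κ * (suc t * G) + t * G ≡ κ * G + 1 * (t * (κ + 1) * G)
      expand = solve-∀
    ... | no a≢b = ≡.trans (≡.cong (λ z → q ^ k * (q * z) + t * N ^ n) (∑-cong Vₙ (λ x → 𝟙-cong
            (form (U a) x x ≟ form (U b) x x) (form (_-M_ F (U a) (U b)) x x ≟ 0#)
            (λ eq → x⊕y≈y⇒x≈0 (trans (form-difference (U a) (U b) x) eq))
            (λ eq → trans (sym (form-difference (U a) (U b) x)) (trans (+-congʳ eq) (+-identityˡ _))))))
        (≡.trans (zeros-count t q≡ _ (hermitian-difference (hermitian a) (hermitian b)) (rank a b a≢b) odd)
          (≡.sym (ℕₚ.+-identityʳ _)))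

    upper : q ^ k * (q * agreements-total) + m * (m * (t * N ^ n)) ≡
            m * (m * (q ^ k * N ^ n)) + m * (t * (q ^ k + 1) * N ^ n)
    upper = begin
      q ^ k * (q * agreements-total) + m * (m * (t * N ^ n))
        ≡⟨ ≡.cong₂ _+_ (≡.sym (≡.trans (∑∑-*ˡ (q ^ k) _) (≡.cong (q ^ k *_) (∑∑-*ˡ q agreements))))
            (≡.sym (∑∑-const _)) ⟩
      (∑[ a ∈ I ] ∑[ b ∈ I ] q ^ k * (q * agreements a b)) + (∑[ a ∈ I ] ∑[ b ∈ I ] t * N ^ n)
        ≡⟨ ∑∑-+ _ _ ⟨
      (∑[ a ∈ I ] ∑[ b ∈ I ] q ^ k * (q * agreements a b) + t * N ^ n)
        ≡⟨ ∑-cong I (λ a → ∑-cong I (λ b → agreements-count a b)) ⟩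
      (∑[ a ∈ I ] ∑[ b ∈ I ] q ^ k * N ^ n + 𝟙 (a Finₚ.≟ b) * (t * (q ^ k + 1) * N ^ n))
        ≡⟨ ∑∑-+ _ _ ⟩
      (∑[ a ∈ I ] ∑[ b ∈ I ] q ^ k * N ^ n) + (∑[ a ∈ I ] ∑[ b ∈ I ] 𝟙 (a Finₚ.≟ b) * (t * (q ^ k + 1) * N ^ n))
        ≡⟨ ≡.cong₂ _+_ (∑∑-const _) (≡.trans (∑-cong I diagonal) (∑-const I _)) ⟩
      m * (m * (q ^ k * N ^ n)) + m * (t * (q ^ k + 1) * N ^ n) ∎
      where
      open ≡.≡-Reasoning
      ∑∑-*ˡ : ∀ s (g : Fin m → Fin m → ℕ) → (∑[ a ∈ I ] ∑[ b ∈ I ] s * g a b) ≡ s * (∑[ a ∈ I ] ∑[ b ∈ I ] g a b)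
      ∑∑-*ˡ s g = ≡.trans (∑-cong I (λ a → ∑-*ˡ I s (g a))) (∑-*ˡ I s _)
      ∑∑-+ : ∀ (g g′ : Fin m → Fin m → ℕ) → (∑[ a ∈ I ] ∑[ b ∈ I ] g a b + g′ a b) ≡
             (∑[ a ∈ I ] ∑[ b ∈ I ] g a b) + (∑[ a ∈ I ] ∑[ b ∈ I ] g′ a b)
      ∑∑-+ g g′ = ≡.trans (∑-cong I (λ a → ∑-+ I (g a) (g′ a))) (∑-+ I _ _)
      ∑∑-const : ∀ s → (∑[ a ∈ I ] ∑[ b ∈ I ] s) ≡ m * (m * s)
      ∑∑-const s = ≡.trans (∑-cong I (λ a → ∑-const I s)) (∑-const I (m * s))
      diagonal : ∀ a → (∑[ b ∈ I ] 𝟙 (a Finₚ.≟ b) * (t * (q ^ k + 1) * N ^ n)) ≡ t * (q ^ k + 1) * N ^ n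
      diagonal a = ≡.trans (∑-cong I (λ b → ℕₚ.*-comm (𝟙 (a Finₚ.≟ b)) _))
          (≡.trans (∑-*ˡ I (t * (q ^ k + 1) * N ^ n) (λ b → 𝟙 (a Finₚ.≟ b)))
        (≡.trans (≡.cong (t * (q ^ k + 1) * N ^ n *_)
            (∑-unique I (λ b → a Finₚ.≟ b) a (λ _ → ≡.sym) (λ _ → ≡.sym))) (ℕₚ.*-identityʳ _)))

    -- At x = 0 all the forms agree, which improves on Cauchy–Schwarz by a factor q.
    lower : N ^ n * (m * m) + t * (m * m) ≤ q * agreements-total
    lower = begin
      N ^ n * (m * m) + t * (m * m)
        ≡⟨ ≡.cong₂ _+_ (∑-const Vₙ (m * m)) (≡.trans (∑-*ˡ Vₙ (t * (m * m)) _)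
             (≡.trans (≡.cong (t * (m * m) *_) (∑-indicator Vₙ 0ᵥ)) (ℕₚ.*-identityʳ _))) ⟨
      (∑[ x ∈ Vₙ ] m * m) + (∑[ x ∈ Vₙ ] t * (m * m) * 𝟙 (x ≟ᵥ 0ᵥ))
        ≡⟨ ∑-+ Vₙ _ _ ⟨
      (∑[ x ∈ Vₙ ] m * m + t * (m * m) * 𝟙 (x ≟ᵥ 0ᵥ))
        ≤⟨ ∑-mono Vₙ pointwise ⟩
      (∑[ x ∈ Vₙ ] q * collisions x)
        ≡⟨ ∑-*ˡ Vₙ q _ ⟩
      q * (∑[ x ∈ Vₙ ] collisions x)
        ≡⟨ ≡.cong (q *_) (≡.trans (∑-swap Vₙ I _) (∑-cong I (λ a → ∑-swap Vₙ I _))) ⟩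
      q * agreements-total ∎
      where
      open ℕₚ.≤-Reasoning
      collisions : V n → ℕ
      collisions x = ∑[ a ∈ I ] ∑[ b ∈ I ] 𝟙 (form (U a) x x ≟ form (U b) x x)
      pointwise : ∀ x → m * m + t * (m * m) * 𝟙 (x ≟ᵥ 0ᵥ) ≤ q * collisions x
      pointwise x with x ≟ᵥ 0ᵥ
      ... | no _ = ≡.subst (_≤ q * collisions x)
        (≡.sym (≡.trans (≡.cong (m * m +_) (ℕₚ.*-zeroʳ (t * (m * m)))) (ℕₚ.+-identityʳ _)))
        (collision-count (λ a → form (U a) x x) (λ a → form-fixed (hermitian a) x))
      -- All m² pairs collide at 0, and q m² = m² + t m² supplies exactly the surplus.
      ... | yes x≋0 = ℕₚ.≤-reflexive (≡.trans (≡.cong (m * m +_) (ℕₚ.*-identityʳ _))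
        (≡.sym (≡.cong₂ _*_ q≡
            (≡.trans (∑-cong I (λ a → ≡.trans (∑-cong I (λ b → 𝟙-yes (form (U a) x x ≟ form (U b) x x) (agree a b)))
          (≡.trans (∑-const I 1) (ℕₚ.*-identityʳ m)))) (∑-const I m)))))
        where
        vanish : ∀ a → form (U a) x x ≈ 0#
        vanish a = dot-0ˡ (λ i → trans (conj-cong (x≋0 i)) conj-0) (apply (U a) x)
        agree : ∀ a b → form (U a) x x ≈ form (U b) x x
        agree a b = trans (vanish a) (sym (vanish b))

    size-bound : m ≤ q ^ k
    size-bound = counting-bound m (q ^ k) t (N ^ n) (q * agreements-total)
      (ℕₚ.m^n>0 q {{ℕ.>-nonZero (ℕₚ.<⇒≤ (prime-power≥2 primePower))}} k)
      (ℕₚ.pred-mono-≤ (prime-power≥2 primePower)) upper lower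

theorem4p3 : ∀ {c ℓ : Level} (F : CommutativeRing c ℓ) → IsField F →
    (q : ℕ) → IsPrimePower q → HasCardinality F (q ^ 2) →
    (n : ℕ) → 1 ≤ n → (k : ℕ) → OddNat k → 1 ≤ k → k ≤ n →
    (m : ℕ) → (U : Fin m → Mat F n) →
    (∀ a → IsHermitian F q (U a)) →
    (∀ a b → a ≢ b → HasRank F (_-M_ F (U a) (U b)) k) →
    (∀ a → ¬ IsZeroMat F (U a) → HasRank F (U a) k) →
    m ≤ q ^ k
theorem4p3 F isField q primePower card n _ k odd _ _ m U hermitian rank _ =
  ConstantRankDistance.size-bound odd U hermitian rank
  where open HermitianMatrices F isField primePower card
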